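{- Let $\mathcal{D}$ be the set of partitions into distinct parts and $\mathcal{U}$ the set of all partitions. As formal power series in $q$, $$\sum_{\pi\in\mathcal{D}} \widetilde{\omega}_2(\pi)\, q^{|\pi|} = \sum_{\pi\in\mathcal{U}} \omega_2'(\pi)\, q^{|\pi|} = \sum_{\pi\in\mathcal{U}} \omega_2^*(\pi)\, q^{|\pi|},$$ where the weights $\widetilde{\omega}_2$, $\omega_2'$, $\omega_2^*$ are as defined in the context.
   Context: A partition $\pi=(\lambda_1,\lambda_2,\dots,\lambda_{\nu(\pi)})$ is a finite non-increasing sequence of positive integers (its parts); $\nu(\pi)$ is the number of parts and $|\pi|$ is the sum of the parts. The empty sequence is the unique partition of $0$, and it belongs to both $\mathcal{D}$ and $\mathcal{U}$. Empty products equal $1$. $f_i(\pi)$ denotes the number of occurrences of $i$ as a part of $\pi$. $\chi(\text{statement})$ equals $1$ if the statement is true and $0$ otherwise. With the convention $\lambda_{\nu(\pi)+1}:=0$, $$\widetilde{\omega}_2(\pi)=\prod_{i=1}^{\nu(\pi)}(2\lambda_i-2\lambda_{i+1}-1).$$ Let $\nu_{de}(\pi)$ be the number of different even parts of $\pi$ (not counting repetitions), and for an integer $n$ let $\mu_{n,o}(\pi)$ be the number of different odd parts of $\pi$ (not counting repetitions) that are $\geq n$. Then $$\omega_2'(\pi)=2^{\nu_{de}(\pi)}\left(1+\sum_{i\geq 0}\chi\big((4i+3)\in\pi\big)\,2^{\mu_{4i+3,o}(\pi)}\right),$$ where $(4i+3)\in\pi$ means that $4i+3$ is a part of $\pi$.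 Finally, $$\omega_2^*(\pi)=\big(1-\chi(f_1(\pi)\geq 2)\big)\prod_{n\geq 2}2^{\chi(f_n(\pi)\geq 1)}+\sum_{j\geq 1}\left(\chi(f_{2j+1}(\pi)\leq 1)\,\chi(f_j(\pi)\geq 2)\,2^{\chi(f_j(\pi)\geq 3)}\prod_{i=1}^{j-1}\chi(f_i(\pi)\geq 3)\,2^{\chi(f_i(\pi)\geq 4)}\prod_{\substack{n>j,\\ n\neq 2j+1}}2^{\chi(f_n(\pi)\geq 1)}\right),$$ where the factor $2^{\chi(f_i(\pi)\geq 4)}$ is inside the product over $i$. For each $\pi$ the sum over $j$ has only finitely many nonzero terms. -}

module Defs where

open import Data.Nat.Base using (ℕ; zero; suc; _+_; _*_; _∸_; _^_; _≤_; _<_; _≥_; z≤n; s≤s; s≤s⁻¹)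
open import Data.Nat.Properties
  using (_≟_; _≤?_; ≤-refl; ≤-trans; ≤-reflexive; <-irrefl; <⇒≱; ≤∧≢⇒<; m≤n⇒m≤1+n;
         m≤m+n; m≤n+m; m≤m*n; m+n∸m≡n; m+[n∸m]≡n; +-assoc; +-cancelʳ-≡)
open import Data.Nat.Divisibility using (_∣?_)
open import Data.Nat.ListAction using (sum)
open import Data.Nat.ListAction.Properties using (sum-++)
open import Data.Integer.Base as ℤ using (ℤ; +_; 0ℤ; 1ℤ)
open import Data.List.Base
  using (List; []; _∷_; _++_; map; foldr; filter; concatMap; length; replicate;
         upTo; applyUpTo; deduplicate)
open import Data.List.Properties using (filter-++; filter-none; filter-all; length-++; length-replicate; ++-cancelˡ)
open import Data.List.Membership.Propositional using (_∈_)
open import Data.List.Membership.Propositional.Properties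
  using (∈-map⁺; ∈-map⁻; ∈-filter⁺; ∈-filter⁻; ∈-upTo⁺; ∈-concat⁺′; ∈-concat⁻′)
open import Data.List.Membership.DecPropositional _≟_ using (_∈?_)
open import Data.List.Relation.Unary.All as All using (All; []; _∷_)
import Data.List.Relation.Unary.All.Properties as All
open import Data.List.Relation.Unary.Any using (here)
import Data.List.Relation.Unary.AllPairs as AllPairs
import Data.List.Relation.Unary.AllPairs.Properties as AllPairs
open import Data.List.Relation.Unary.Linked as Linked using (Linked; []; [-]; _∷_)
open import Data.List.Relation.Unary.Linked.Properties using (Linked⇒All)
open import Data.List.Relation.Unary.Unique.Propositional using (Unique)
import Data.List.Relation.Unary.Unique.Propositional.Properties as Unique
open import Data.List.Relation.Unary.Unique.DecPropositional _≟_ using (unique?)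
open import Data.Product.Base using (_×_; _,_; proj₁; proj₂; ∃₂)
open import Function.Bundles using (_⇔_; mk⇔)
open import Relation.Nullary.Decidable using (Dec; yes; no; does; ¬?; _×-dec_)
open import Relation.Nullary.Negation using (contradiction)
open import Relation.Binary.PropositionalEquality
  using (_≡_; _≢_; refl; sym; trans; cong; cong₂; subst)
open import Data.Bool.Base using (if_then_else_)

∑ : {A : Set} → List A → (A → ℤ) → ℤ
∑ xs f = foldr (λ x s → f x ℤ.+ s) 0ℤ xs

∏ : {A : Set} → List A → (A → ℤ) → ℤ
∏ xs f = foldr (λ x p → f x ℤ.* p) 1ℤ xs

syntax ∑ xs (λ x → t) = ∑[ x ∈ xs ] t
syntax ∏ xs (λ x → t) = ∏[ x ∈ xs ] t

infix 5 ∑ ∏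

-- The integers a, a + 1, …, b; empty when b < a.
range : ℕ → ℕ → List ℕ
range a b = applyUpTo (λ i → a + i) (suc b ∸ a)

χ : {P : Set} → Dec P → ℤ
χ P? = if does P? then 1ℤ else 0ℤ

2^_ : ℕ → ℤ
2^ k = + (2 ^ k)

2^χ : {P : Set} → Dec P → ℤ
2^χ P? = if does P? then 2^ 1 else 2^ 0

IsPartition : List ℕ → Set
IsPartition π = Linked _≥_ π × All (0 <_) π

-- |π|
size : List ℕ → ℕ
size = sum

freq : ℕ → List ℕ → ℕ
freq i π = length (filter (i ≟_) π)

-- All partitions of n with parts at most m, built by choosing the multiplicity k of the
-- largest admissible part.
partitionsUpTo : ℕ → ℕ → List (List ℕ)
partitionsUpTo zero    zero    = [] ∷ []
partitionsUpTo zero    (suc _) = []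
partitionsUpTo (suc m) n       =
  concatMap (λ k → map (replicate k (suc m) ++_) (partitionsUpTo m (n ∸ k * suc m)))
            (filter (λ k → k * suc m ≤? n) (upTo (suc n)))

-- The partitions of n in 𝒰 and in 𝒟; see ∈-𝒰, ∈-𝒟, 𝒰-unique, 𝒟-unique below.
𝒰 : ℕ → List (List ℕ)
𝒰 n = partitionsUpTo n n

𝒟 : ℕ → List (List ℕ)
𝒟 n = filter unique? (𝒰 n)

-- In the weights, indices of the infinite sums and products are cut off at N = |π|: no part
-- exceeds N, so by freq-above every later summand is 0 and every later factor is 1.

-- The convention λ_{ν(π)+1} = 0.
firstPart : List ℕ → ℕ
firstPart []      = 0
firstPart (x ∷ _) = x

ω̃₂ : List ℕ → ℤ
ω̃₂ []      = 1ℤ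
ω̃₂ (x ∷ π) = (+ 2 ℤ.* + x ℤ.- + 2 ℤ.* + firstPart π ℤ.- 1ℤ) ℤ.* ω̃₂ π

ν-de : List ℕ → ℕ
ν-de π = length (filter (2 ∣?_) (deduplicate _≟_ π))

μ-o : ℕ → List ℕ → ℕ
μ-o n π = length (filter (λ k → ¬? (2 ∣? k) ×-dec (n ≤? k)) (deduplicate _≟_ π))

ω₂′ : List ℕ → ℤ
ω₂′ π = 2^ (ν-de π) ℤ.*
  (1ℤ ℤ.+ (∑[ i ∈ range 0 N ] χ ((4 * i + 3) ∈? π) ℤ.* 2^ (μ-o (4 * i + 3) π)))
  where
  N : ℕ
  N = size π

ω₂* : List ℕ → ℤ
ω₂* π =
  (1ℤ ℤ.- χ (2 ≤? f 1)) ℤ.* (∏[ n ∈ range 2 N ] 2^χ (1 ≤? f n))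
  ℤ.+
  (∑[ j ∈ range 1 N ]
    (χ (f (2 * j + 1) ≤? 1) ℤ.* χ (2 ≤? f j) ℤ.* 2^χ (3 ≤? f j)
     ℤ.* (∏[ i ∈ range 1 (j ∸ 1) ] (χ (3 ≤? f i) ℤ.* 2^χ (4 ≤? f i)))
     ℤ.* (∏[ n ∈ filter (λ n → ¬? (n ≟ 2 * j + 1)) (range (suc j) N) ] 2^χ (1 ≤? f n))))
  where
  N : ℕ
  N = size π
  f : ℕ → ℕ
  f i = freq i π

-- A formal power series in q with integer coefficients, as its coefficient sequence.
PowerSeries : Set
PowerSeries = ℕ → ℤ

-- Σ_{π ∈ S} w(π) q^{|π|}, where S n lists the elements of S of size n.
∑q : (ℕ → List (List ℕ)) → (List ℕ → ℤ) → PowerSeries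
∑q S w n = ∑[ π ∈ S n ] w π

parts≤size : ∀ π → All (_≤ size π) π
parts≤size []      = []
parts≤size (x ∷ π) =
  m≤m+n x (size π) ∷ All.map (λ y≤ → ≤-trans y≤ (m≤n+m (size π) x)) (parts≤size π)

freq-above : ∀ {i} π → size π < i → freq i π ≡ 0
freq-above {i} π s<i =
  cong length (filter-none (i ≟_) (All.map (λ { y≤ refl → <⇒≱ s<i y≤ }) (parts≤size π)))

private
  sum-replicate : ∀ k x → sum (replicate k x) ≡ k * x
  sum-replicate zero    x = refl
  sum-replicate (suc k) x = cong (_+_ x) (sum-replicate k x)

  freq-replicate : ∀ k x → freq x (replicate k x) ≡ k
  freq-replicate k x =
    trans (cong length (filter-all (x ≟_) (All.replicate⁺ k refl))) (length-replicate k)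

  freq-++ : ∀ i xs ys → freq i (xs ++ ys) ≡ freq i xs + freq i ys
  freq-++ i xs ys = trans (cong length (filter-++ (i ≟_) xs ys)) (length-++ (filter (i ≟_) xs))

  freq-bounded : ∀ {m} {ρ : List ℕ} → All (_≤ m) ρ → freq (suc m) ρ ≡ 0
  freq-bounded ρ≤m =
    cong length (filter-none (_ ≟_) (All.map (λ { x≤m refl → <-irrefl refl x≤m }) ρ≤m))

  freq-leading : ∀ k {m ρ} → All (_≤ m) ρ → freq (suc m) (replicate k (suc m) ++ ρ) ≡ k + 0
  freq-leading k {m} {ρ} ρ≤m = trans (freq-++ (suc m) (replicate k (suc m)) ρ)
    (cong₂ _+_ (freq-replicate k (suc m)) (freq-bounded ρ≤m))

  BoundedPartition : ℕ → ℕ → List ℕ → Set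
  BoundedPartition m n π = IsPartition π × All (_≤ m) π × size π ≡ n

  linked-∷ : ∀ {x π} → All (_≤ x) π → Linked _≥_ π → Linked _≥_ (x ∷ π)
  linked-∷ []        []       = [-]
  linked-∷ (y≤x ∷ _) [-]      = y≤x ∷ [-]
  linked-∷ (y≤x ∷ _) (r ∷ rs) = y≤x ∷ r ∷ rs

  prepend : ∀ k {m n ρ} → BoundedPartition m n ρ →
            BoundedPartition (suc m) (k * suc m + n) (replicate k (suc m) ++ ρ)
  prepend zero    ((ls , ps) , bs , refl) = (ls , ps) , All.map m≤n⇒m≤1+n bs , refl
  prepend (suc k) {m} {n} b with prepend k b
  ... | (ls , ps) , bs , eq =
    (linked-∷ bs ls , s≤s z≤n ∷ ps) , ≤-refl ∷ bs ,
    trans (cong (_+_ (suc m)) eq) (sym (+-assoc (suc m) (k * suc m) n))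

  split : ∀ {m} π → IsPartition π → All (_≤ suc m) π →
          ∃₂ λ k ρ → π ≡ replicate k (suc m) ++ ρ × IsPartition ρ × All (_≤ m) ρ
  split []      p _ = 0 , [] , refl , p , []
  split {m} (x ∷ π) p@(ls , ps) (x≤ ∷ bs) with x ≟ suc m
  ... | no x≢ = 0 , x ∷ π , refl , p ,
    All.map (λ y≤x → ≤-trans y≤x (s≤s⁻¹ (≤∧≢⇒< x≤ x≢))) (Linked⇒All (λ y≤x z≤y → ≤-trans z≤y y≤x) ≤-refl ls)
  ... | yes refl with split π (Linked.tail ls , All.tail ps) bs
  ...   | k , ρ , refl , q , r = suc k , ρ , refl , q , r

  block : ℕ → ℕ → ℕ → List (List ℕ)
  block m n k = map (replicate k (suc m) ++_) (partitionsUpTo m (n ∸ k * suc m))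

  multiplicities : ℕ → ℕ → List ℕ
  multiplicities m n = filter (λ k → k * suc m ≤? n) (upTo (suc n))

  sound : ∀ m n {π} → π ∈ partitionsUpTo m n → BoundedPartition m n π
  sound zero    zero    (here refl) = ([] , []) , [] , refl
  sound (suc m) n π∈ with ∈-concat⁻′ (map (block m n) (multiplicities m n)) π∈
  ... | _ , π∈b , b∈ with ∈-map⁻ (block m n) b∈
  ... | k , k∈ , refl with ∈-map⁻ (replicate k (suc m) ++_) π∈b
  ... | ρ , ρ∈ , refl =
    subst (λ s → BoundedPartition (suc m) s (replicate k (suc m) ++ ρ))
          (m+[n∸m]≡n (proj₂ (∈-filter⁻ (λ k → k * suc m ≤? n) {xs = upTo (suc n)} k∈)))
          (prepend k (sound m (n ∸ k * suc m) ρ∈))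

  complete : ∀ m n {π} → BoundedPartition m n π → π ∈ partitionsUpTo m n
  complete zero n {[]}    (_ , _ , refl) = here refl
  complete zero n {x ∷ π} ((_ , 0<x ∷ _) , x≤0 ∷ _ , _) = contradiction x≤0 (<⇒≱ 0<x)
  complete (suc m) n {π} (p , bs , eq) with split π p bs
  ... | k , ρ , refl , q , r =
    ∈-concat⁺′ (∈-map⁺ (replicate k (suc m) ++_) (complete m (n ∸ k * suc m) (q , r , sizeρ)))
               (∈-map⁺ (block m n) (∈-filter⁺ (λ k → k * suc m ≤? n)
                  (∈-upTo⁺ (s≤s (≤-trans (m≤m*n k (suc m)) k≤))) k≤))
    where
    total : k * suc m + size ρ ≡ n
    total = trans (sym (trans (sum-++ (replicate k (suc m)) ρ)
                              (cong (λ s → s + size ρ) (sum-replicate k (suc m))))) eq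
    k≤ : k * suc m ≤ n
    k≤ = ≤-trans (m≤m+n _ _) (≤-reflexive total)
    sizeρ : size ρ ≡ n ∸ k * suc m
    sizeρ = trans (sym (m+n∸m≡n (k * suc m) (size ρ))) (cong (_∸ k * suc m) total)

  unique-upTo : ∀ m n → Unique (partitionsUpTo m n)
  unique-upTo zero    zero    = [] AllPairs.∷ AllPairs.[]
  unique-upTo zero    (suc n) = AllPairs.[]
  unique-upTo (suc m) n = Unique.concat⁺
    (All.map⁺ (All.tabulate (λ {k} _ →
      Unique.map⁺ (++-cancelˡ (replicate k (suc m)) _ _) (unique-upTo m (n ∸ k * suc m)))))
    (AllPairs.map⁺ (AllPairs.map disjoint
      (Unique.filter⁺ (λ k → k * suc m ≤? n) (Unique.upTo⁺ (suc n)))))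
    where
    multiplicity : ∀ k {π} → π ∈ block m n k → freq (suc m) π ≡ k + 0
    multiplicity k π∈ with ∈-map⁻ (replicate k (suc m) ++_) π∈
    ... | ρ , ρ∈ , refl = freq-leading k (proj₁ (proj₂ (sound m (n ∸ k * suc m) ρ∈)))
    disjoint : ∀ {k l} → k ≢ l → ∀ {π} → π ∈ block m n k × π ∈ block m n l → _
    disjoint {k} {l} k≢l (π∈k , π∈l) = k≢l
      (+-cancelʳ-≡ 0 k l (trans (sym (multiplicity k π∈k)) (multiplicity l π∈l)))

∈-𝒰 : ∀ n π → π ∈ 𝒰 n ⇔ (IsPartition π × size π ≡ n)
∈-𝒰 n π = mk⇔
  (λ π∈ → let p , _ , eq = sound n n π∈ in p , eq)
  (λ { (p , refl) → complete n n (p , parts≤size π , refl) })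

𝒰-unique : ∀ n → Unique (𝒰 n)
𝒰-unique n = unique-upTo n n

∈-𝒟 : ∀ n π → π ∈ 𝒟 n ⇔ (IsPartition π × Unique π × size π ≡ n)
∈-𝒟 n π = mk⇔
  (λ π∈ → let π∈𝒰 , u = ∈-filter⁻ unique? {xs = 𝒰 n} π∈
              p , _ , eq = sound n n π∈𝒰
          in p , u , eq)
  (λ { (p , u , refl) → ∈-filter⁺ unique? (complete n n (p , parts≤size π , refl)) u })

𝒟-unique : ∀ n → Unique (𝒟 n)
𝒟-unique n = Unique.filter⁺ unique? (𝒰-unique n)

{-# OPTIONS --safe #-}

-- Let P = Π (1 + q^i)/(1 − q^i) and F = Σₙ (−1)ⁿ q^(n(n+1)/2)/(−q; q)ₙ. All three series equal P F.
--
-- ω̃₂: grouping by the number of parts gives Σₙ q^(n(n+1)/2) (−q; q)ₙ/(q; q)ₙ², which is P F by a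
-- limiting case of Heine's transformation and the q-Gauss sum.
-- ω₂′: after division by P, the generating function is 2 Σₙ (−1)ⁿ/(−q; q²)ₙ₊₁ in the sense of Abel
-- summation; a symmetry of Rogers–Fine type identifies it with F.
-- ω₂*: each summand of the weight is a product over the parts, so the generating function is
-- P Σⱼ q^(j(3j+1)/2) (1 − q^(2j+1)), and the false theta series is F by the Rogers–Fine identity.
--
-- Each q-series is characterised by a recurrence X i = c i + q (v i · X i + r i · X (σ i)) in its
-- integer parameters, which has a unique solution in ℤ⟦q⟧; an identity is proved by showing that the
-- difference of its two sides satisfies a recurrence of this form with c = 0.
module Submission where

open import Defs
open import Level using (0ℓ)
open import Algebra.Bundles using (CommutativeRing)
open import Data.Bool.Base using (Bool; true; false; if_then_else_)
open import Data.Integer.Base as ℤ using (ℤ; +_; 0ℤ; 1ℤ)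
import Data.Integer.Properties as ℤ
open import Data.Integer.Tactic.RingSolver using (solve-∀)
open import Data.List.Base using (List; []; _∷_; _++_; map; foldr; filter; concatMap;
  replicate; upTo; applyUpTo; deduplicate; length)
open import Data.List.Properties using (map-upTo; applyUpTo-∷ʳ; filter-++;
  filter-none; filter-all; filter-accept; filter-reject)
import Data.List.Properties as List
open import Data.List.Membership.Propositional using (_∈_; _∉_)
open import Data.List.Membership.Propositional.Properties using (∈-++⁺ʳ)
open import Data.List.Relation.Unary.All as All using (All; []; _∷_)
import Data.List.Relation.Unary.All.Properties as All
open import Data.List.Relation.Unary.AllPairs as AllPairs using ([]; _∷_)
open import Data.List.Relation.Unary.Any using (here; there)
open import Data.Maybe.Base as Maybe using (Maybe)
open import Data.Nat.Base as ℕ using (ℕ; zero; suc; z≤n; s≤s)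
open import Data.Nat.DivMod using (_%_; [m+kn]%n≡m%n)
open import Data.Nat.Divisibility using (_∣_; _∣?_; divides; ∣m∣n⇒∣m+n; ∣m+n∣m⇒∣n; n∣m*n; ∣-trans; ∣1⇒≡1)
open import Data.Nat.Properties using (_≟_; _≤?_; _<?_; ≤-refl; ≤-trans; <⇒≤; <⇒≢; <⇒≱; <-irrefl;
  <-≤-trans; m≤n⇒m≤1+n; n≤1+n; m≤n+m; m≤m*n; m∸n+n≡m; +-suc; +-identityʳ; suc-injective)
import Data.Nat.Properties as ℕ
open import Data.List.Membership.DecPropositional _≟_ using (_∈?_)
open import Data.List.Relation.Unary.Unique.DecPropositional _≟_ using (unique?)
open import Data.Product.Base using (_×_; _,_; proj₁; proj₂; Σ-syntax)
open import Data.Unit.Base using (⊤; tt)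
open import Function.Base using (_∘_; id)
open import Function.Bundles using (_⇔_; mk⇔; Equivalence)
open import Relation.Binary.PropositionalEquality as ≡ using (_≡_; _≢_; _≗_; cong; cong₂)
open import Relation.Nullary.Decidable using (Dec; yes; no; does; ¬?; _×-dec_; does-⇔; dec-true; dec-false;
  dec⇒maybe)
open import Relation.Nullary.Negation using (¬_; contradiction)
open import Relation.Unary using (Decidable)
open import Algebra.Solver.Ring.AlmostCommutativeRing using (fromCommutativeRing; _-Raw-AlmostCommutative⟶_)
import Algebra.Construct.Pointwise ℕ as Pointwise
import Algebra.Solver.Ring

-- Formal power series

-- Neither division nor an infinite sum is used as such. A product of denominators with constant
-- term 1 is written 1 - q v; moving q v X to the right turns the functional equation of a q-series
-- into a contraction. This is the origin of the coefficients `v` and `r` in each definition.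
--
-- Diagonal recurrences raise both parameters and so leave a = 0 at once. Relations that are wanted
-- only at a = 0 are therefore proved for all a; setting a = 0 afterwards kills a term or turns 1 +
-- q^a into 2.
--
-- The obstacle for ω₂′ is that its alternating series diverges: the recurrence (1 + q^(a+1)) T a =
-- 2 - T (a + 2) has no factor q in front of T (a + 2), so it does not determine T. The series is
-- defined instead as 1 - q^(a+1) S a, where S satisfies a contractive recurrence.
--
-- Limits are replaced by exact identities with a remainder divisible by a power of q beyond the
-- coefficient under comparison. This also reconciles the index cutoffs in the weights with the
-- unrestricted series.

infixl 7 _⊛_

_⊛_ : PowerSeries → PowerSeries → PowerSeries
(x ⊛ y) zero    = x 0 ℤ.* y 0
(x ⊛ y) (suc n) = x 0 ℤ.* y (suc n) ℤ.+ ((x ∘ suc) ⊛ y) n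

constant : ℤ → PowerSeries
constant c zero    = c
constant c (suc n) = 0ℤ

⊛-cong : ∀ {x x′ y y′} → x ≗ x′ → y ≗ y′ → x ⊛ y ≗ x′ ⊛ y′
⊛-cong p r zero    = cong₂ ℤ._*_ (p 0) (r 0)
⊛-cong p r (suc n) = cong₂ ℤ._+_ (cong₂ ℤ._*_ (p 0) (r (suc n))) (⊛-cong (p ∘ suc) r n)

⊛-distribʳ : ∀ z x y → (λ n → x n ℤ.+ y n) ⊛ z ≗ (λ n → (x ⊛ z) n ℤ.+ (y ⊛ z) n)
⊛-distribʳ z x y zero    = ℤ.*-distribʳ-+ (z 0) (x 0) (y 0)
⊛-distribʳ z x y (suc n) = ≡.trans
  (cong (ℤ._+_ ((x 0 ℤ.+ y 0) ℤ.* z (suc n))) (⊛-distribʳ z (x ∘ suc) (y ∘ suc) n))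
  (regroup (x 0) (y 0) (z (suc n)) (((x ∘ suc) ⊛ z) n) (((y ∘ suc) ⊛ z) n))
  where
  regroup : ∀ a b c d e → (a ℤ.+ b) ℤ.* c ℤ.+ (d ℤ.+ e) ≡ (a ℤ.* c ℤ.+ d) ℤ.+ (b ℤ.* c ℤ.+ e)
  regroup = solve-∀

-- The defining recursion strips the left factor; `⊛-comm` matches it against this expansion, which
-- strips the right one.
⊛-lastTerm : ∀ x y n → (x ⊛ y) (suc n) ≡ x (suc n) ℤ.* y 0 ℤ.+ (x ⊛ (y ∘ suc)) n
⊛-lastTerm x y zero    = ℤ.+-comm (x 0 ℤ.* y 1) (x 1 ℤ.* y 0)
⊛-lastTerm x y (suc n) = ≡.trans
  (cong (ℤ._+_ (x 0 ℤ.* y (suc (suc n)))) (⊛-lastTerm (x ∘ suc) y n))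
  (swap (x 0 ℤ.* y (suc (suc n))) (x (suc (suc n)) ℤ.* y 0) (((x ∘ suc) ⊛ (y ∘ suc)) n))
  where
  swap : ∀ a b c → a ℤ.+ (b ℤ.+ c) ≡ b ℤ.+ (a ℤ.+ c)
  swap = solve-∀

⊛-comm : ∀ x y → x ⊛ y ≗ y ⊛ x
⊛-comm x y zero    = ℤ.*-comm (x 0) (y 0)
⊛-comm x y (suc n) = ≡.trans
  (cong₂ ℤ._+_ (ℤ.*-comm (x 0) (y (suc n))) (⊛-comm (x ∘ suc) y n))
  (≡.sym (⊛-lastTerm y x n))

⊛-scaleˡ : ∀ c x y → (λ n → c ℤ.* x n) ⊛ y ≗ (λ n → c ℤ.* (x ⊛ y) n)
⊛-scaleˡ c x y zero    = ℤ.*-assoc c (x 0) (y 0)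
⊛-scaleˡ c x y (suc n) = ≡.trans
  (cong₂ ℤ._+_ (ℤ.*-assoc c (x 0) (y (suc n))) (⊛-scaleˡ c (x ∘ suc) y n))
  (≡.sym (ℤ.*-distribˡ-+ c (x 0 ℤ.* y (suc n)) (((x ∘ suc) ⊛ y) n)))

⊛-assoc : ∀ x y z → (x ⊛ y) ⊛ z ≗ x ⊛ (y ⊛ z)
⊛-assoc x y z zero    = ℤ.*-assoc (x 0) (y 0) (z 0)
⊛-assoc x y z (suc n) = begin
  x 0 ℤ.* y 0 ℤ.* z (suc n) ℤ.+ (((x ⊛ y) ∘ suc) ⊛ z) n
    ≡⟨ cong (ℤ._+_ (x 0 ℤ.* y 0 ℤ.* z (suc n))) (≡.trans
         (⊛-distribʳ z (λ k → x 0 ℤ.* y (suc k)) ((x ∘ suc) ⊛ y) n)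
         (cong₂ ℤ._+_ (⊛-scaleˡ (x 0) (y ∘ suc) z n) (⊛-assoc (x ∘ suc) y z n))) ⟩
  x 0 ℤ.* y 0 ℤ.* z (suc n) ℤ.+ (x 0 ℤ.* ((y ∘ suc) ⊛ z) n ℤ.+ ((x ∘ suc) ⊛ (y ⊛ z)) n)
    ≡⟨ regroup (x 0) (y 0) (z (suc n)) (((y ∘ suc) ⊛ z) n) (((x ∘ suc) ⊛ (y ⊛ z)) n) ⟩
  x 0 ℤ.* (y 0 ℤ.* z (suc n) ℤ.+ ((y ∘ suc) ⊛ z) n) ℤ.+ ((x ∘ suc) ⊛ (y ⊛ z)) n ∎
  where
  open ≡.≡-Reasoning
  regroup : ∀ a b c d e → a ℤ.* b ℤ.* c ℤ.+ (a ℤ.* d ℤ.+ e) ≡ a ℤ.* (b ℤ.* c ℤ.+ d) ℤ.+ e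
  regroup = solve-∀

⊛-zeroˡ : ∀ y → (λ _ → 0ℤ) ⊛ y ≗ (λ _ → 0ℤ)
⊛-zeroˡ y zero    = ≡.refl
⊛-zeroˡ y (suc n) = ≡.trans (ℤ.+-identityˡ _) (⊛-zeroˡ y n)

constant-⊛ : ∀ c y → constant c ⊛ y ≗ (λ n → c ℤ.* y n)
constant-⊛ c y zero    = ≡.refl
constant-⊛ c y (suc n) = ≡.trans (cong (ℤ._+_ (c ℤ.* y (suc n))) (⊛-zeroˡ y n)) (ℤ.+-identityʳ _)

⊛-identityˡ : ∀ y → constant 1ℤ ⊛ y ≗ y
⊛-identityˡ y n = ≡.trans (constant-⊛ 1ℤ y n) (ℤ.*-identityˡ (y n))

opaque
  -- Opaque, so that identities between series are checked with the ring operations as atoms;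
  -- coefficients are visible only in blocks that unfold it.
  ℤ⟦q⟧ : CommutativeRing 0ℓ 0ℓ
  ℤ⟦q⟧ = record
    { Carrier = PowerSeries
    ; _≈_     = _≗_
    ; _+_     = λ x y n → x n ℤ.+ y n
    ; _*_     = _⊛_
    ; -_      = λ x n → ℤ.- x n
    ; 0#      = λ _ → 0ℤ
    ; 1#      = constant 1ℤ
    ; isCommutativeRing = record
      { isRing = record
        { +-isAbelianGroup = Pointwise.isAbelianGroup ℤ.+-0-isAbelianGroup
        ; *-cong     = ⊛-cong
        ; *-assoc    = ⊛-assoc
        ; *-identity = ⊛-identityˡ , λ y n → ≡.trans (⊛-comm y (constant 1ℤ) n) (⊛-identityˡ y n)
        ; distrib    = (λ x y z n → ≡.trans (⊛-comm x _ n) (≡.trans (⊛-distribʳ x y z n)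
                         (cong₂ ℤ._+_ (⊛-comm y x n) (⊛-comm z x n)))) , ⊛-distribʳ
        }
      ; *-comm = ⊛-comm
      }
    }

open CommutativeRing ℤ⟦q⟧ using
  ( _≈_; _+_; _*_; -_; _-_; 0#; 1#; refl; sym; trans; reflexive
  ; +-cong; +-congˡ; +-congʳ; *-cong; *-congˡ; *-congʳ; *-assoc; *-comm)
  renaming (Carrier to Series)

opaque
  unfolding ℤ⟦q⟧

  series : PowerSeries → Series
  series x = x

  coeff : Series → PowerSeries
  coeff x = x

  const : ℤ → Series
  const = constant

  q : Series
  q zero    = 0ℤ
  q (suc n) = constant 1ℤ n

  coeff-series : ∀ x → coeff (series x) ≗ x
  coeff-series x n = ≡.refl

  coeff-cong : ∀ {x y} → x ≈ y → coeff x ≗ coeff y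
  coeff-cong p = p

  coeff-ext : ∀ {x y} → coeff x ≗ coeff y → x ≈ y
  coeff-ext p = p

  coeff-+ : ∀ x y n → coeff (x + y) n ≡ coeff x n ℤ.+ coeff y n
  coeff-+ x y n = ≡.refl

  coeff-const-suc : ∀ c n → coeff (const c) (suc n) ≡ 0ℤ
  coeff-const-suc c n = ≡.refl

  coeff-const* : ∀ c x n → coeff (const c * x) n ≡ c ℤ.* coeff x n
  coeff-const* = constant-⊛

  coeff-const-zero : ∀ c → coeff (const c) 0 ≡ c
  coeff-const-zero c = ≡.refl

  coeff-q*-zero : ∀ x → coeff (q * x) 0 ≡ 0ℤ
  coeff-q*-zero x = ≡.refl

  coeff-q*-suc : ∀ x n → coeff (q * x) (suc n) ≡ coeff x n
  coeff-q*-suc x n = ≡.trans (ℤ.+-identityˡ _) (⊛-identityˡ x n)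

  const-+ : ∀ a b → const (a ℤ.+ b) ≈ const a + const b
  const-+ a b zero    = ≡.refl
  const-+ a b (suc n) = ≡.refl

  const-* : ∀ a b → const (a ℤ.* b) ≈ const a * const b
  const-* a b zero    = ≡.refl
  const-* a b (suc n) = ≡.sym (≡.trans (constant-⊛ a (constant b) (suc n)) (ℤ.*-zeroʳ a))

  const-neg : ∀ a → const (ℤ.- a) ≈ - const a
  const-neg a zero    = ≡.refl
  const-neg a (suc n) = ≡.refl

  const-0 : const 0ℤ ≈ 0#
  const-0 zero    = ≡.refl
  const-0 (suc n) = ≡.refl

  const-1 : const 1ℤ ≈ 1#
  const-1 n = ≡.refl

const-homomorphism : ℤ.+-*-rawRing -Raw-AlmostCommutative⟶ fromCommutativeRing ℤ⟦q⟧
const-homomorphism = record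
  { ⟦_⟧    = const
  ; +-homo = const-+
  ; *-homo = const-*
  ; -‿homo = const-neg
  ; 0-homo = const-0
  ; 1-homo = const-1
  }

-- Equality of series is undecidable, so the solver takes its coefficients in ℤ and compares only
-- those.
const-≟ : ∀ a b → Maybe (const a ≈ const b)
const-≟ a b = Maybe.map (λ a≡b → reflexive (cong const a≡b)) (dec⇒maybe (a ℤ.≟ b))

open Algebra.Solver.Ring ℤ.+-*-rawRing (fromCommutativeRing ℤ⟦q⟧) const-homomorphism const-≟
  using (Polynomial; solve; _:=_; _:+_; _:*_; _:-_; :-_; con)

𝟎 𝟏 𝟐 : Series
𝟎 = const 0ℤ
𝟏 = const 1ℤ
𝟐 = const (+ 2)

-- Congruence modulo q^N

infix 4 _≈[_]_

_≈[_]_ : Series → ℕ → Series → Set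
x ≈[ N ] y = ∀ n → n ℕ.< N → coeff x n ≡ coeff y n

≈⇒≈[] : ∀ {x y N} → x ≈ y → x ≈[ N ] y
≈⇒≈[] p n _ = coeff-cong p n

≈[]-sym : ∀ {x y N} → x ≈[ N ] y → y ≈[ N ] x
≈[]-sym p n n<N = ≡.sym (p n n<N)

≈[]-trans : ∀ {x y z N} → x ≈[ N ] y → y ≈[ N ] z → x ≈[ N ] z
≈[]-trans p r n n<N = ≡.trans (p n n<N) (r n n<N)

≈[]-+ : ∀ {x x′ y y′ N} → x ≈[ N ] x′ → y ≈[ N ] y′ → x + y ≈[ N ] x′ + y′
≈[]-+ {x} {x′} {y} {y′} p r n n<N = ≡.trans (coeff-+ x y n)
  (≡.trans (cong₂ ℤ._+_ (p n n<N) (r n n<N)) (≡.sym (coeff-+ x′ y′ n)))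

opaque
  unfolding ℤ⟦q⟧ coeff

  ≈[]-* : ∀ c {x y N} → x ≈[ N ] y → c * x ≈[ N ] c * y
  ≈[]-* c p zero    n<N = cong (c 0 ℤ.*_) (p 0 n<N)
  ≈[]-* c {x} {y} p (suc n) n<N = cong₂ ℤ._+_ (cong (c 0 ℤ.*_) (p (suc n) n<N))
    (≈[]-* (c ∘ suc) {x} {y} p n (<-pred n<N))
    where
    <-pred : ∀ {m N} → suc m ℕ.< N → m ℕ.< N
    <-pred (s≤s (s≤s p)) = s≤s (m≤n⇒m≤1+n p)

≈[]-q* : ∀ {x y N} → x ≈[ N ] y → q * x ≈[ suc N ] q * y
≈[]-q* {x} {y} p zero    _         = ≡.trans (coeff-q*-zero x) (≡.sym (coeff-q*-zero y))
≈[]-q* {x} {y} p (suc n) (s≤s n<N) =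
  ≡.trans (coeff-q*-suc x n) (≡.trans (p n n<N) (≡.sym (coeff-q*-suc y n)))


coeff-𝟎 : ∀ n → coeff 𝟎 n ≡ 0ℤ
coeff-𝟎 zero    = coeff-const-zero 0ℤ
coeff-𝟎 (suc n) = coeff-const-suc 0ℤ n

-- Contractive systems of linear equations

module Contraction {I : Set} (σ : I → I) (v r : I → Series) where

  step : (I → Series) → I → Series
  step X i = q * (v i * X i + r i * X (σ i))

  -- The factor q in `step` gains one coefficient of precision; existence and uniqueness both rest
  -- on this.
  step-≈[] : ∀ {X Y N} → (∀ i → X i ≈[ N ] Y i) → ∀ i → step X i ≈[ suc N ] step Y i
  step-≈[] p i = ≈[]-q* (≈[]-+ (≈[]-* (v i) (p i)) (≈[]-* (r i) (p (σ i))))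

  -- Induction on the precision N for all indices at once, since `σ` may carry an index arbitrarily
  -- far.
  vanish : (D : I → Series) → (∀ i → D i ≈ step D i) → ∀ i → D i ≈ 𝟎
  vanish D fixed i = coeff-ext (λ n → agree (suc n) i n ≤-refl)
    where
    step-𝟎 : ∀ i → step (λ _ → 𝟎) i ≈ 𝟎
    step-𝟎 i = solve 3 (λ q v r → q :* (v :* con 0ℤ :+ r :* con 0ℤ) := con 0ℤ) refl q (v i) (r i)
    agree : ∀ N i → D i ≈[ N ] 𝟎
    agree zero    i _ ()
    agree (suc N) i = ≈[]-trans (≈⇒≈[] (fixed i))
      (≈[]-trans (step-≈[] (agree N) i) (≈⇒≈[] (step-𝟎 i)))

  iterate : (I → Series) → ℕ → I → Series
  iterate c zero    i = 𝟎
  iterate c (suc N) i = c i + step (iterate c N) i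

  iterate-≈[] : ∀ c {K} N M → K ℕ.≤ N → K ℕ.≤ M → ∀ i → iterate c N i ≈[ K ] iterate c M i
  iterate-≈[] c _ _ z≤n z≤n i _ ()
  iterate-≈[] c (suc N) (suc M) (s≤s K≤N) (s≤s K≤M) i =
    ≈[]-+ (≈⇒≈[] refl) (step-≈[] (iterate-≈[] c N M K≤N K≤M) i)

  -- Diagonal limit: coefficient n no longer changes after n + 1 iterations.
  solution : (I → Series) → I → Series
  solution c i = series (λ n → coeff (iterate c (suc n) i) n)

  solution-≈[] : ∀ c N i → solution c i ≈[ N ] iterate c N i
  solution-≈[] c N i n n<N =
    ≡.trans (coeff-series _ n) (iterate-≈[] c (suc n) N ≤-refl n<N i n ≤-refl)

  solution-eq : ∀ c i → solution c i ≈ c i + step (solution c) i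
  solution-eq c i = coeff-ext (λ n → ≡.trans (coeff-series _ n)
    (≈[]-+ (≈⇒≈[] refl) (step-≈[] (λ j → ≈[]-sym (solution-≈[] c n j)) i) n ≤-refl))

x-y≈𝟎⇒x≈y : ∀ {x y} → x - y ≈ 𝟎 → x ≈ y
x-y≈𝟎⇒x≈y {x} {y} p = trans (solve 2 (λ x y → x := (x :- y) :+ y) refl x y)
  (trans (+-congʳ p) (solve 1 (λ y → con 0ℤ :+ y := y) refl y))

-- Proof by certificate: c is the multiplier with which the hypothesis a ≈ b enters, and the
-- remaining premise is a polynomial identity for the solver.
combine₁ : ∀ {x y} c {a b} → a ≈ b → x ≈ y + c * (a - b) → x ≈ y
combine₁ {x} {y} c {a} {b} p e = trans e (trans (+-congˡ (*-congˡ (+-congʳ p)))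
  (solve 3 (λ y c b → y :+ c :* (b :- b) := y) refl y c b))

combine₂ : ∀ {x y} c {a b} c′ {a′ b′} → a ≈ b → a′ ≈ b′ →
           x ≈ y + c * (a - b) + c′ * (a′ - b′) → x ≈ y
combine₂ c c′ p p′ e = combine₁ c p (combine₁ c′ p′ e)

combine₃ : ∀ {x y} c {a b} c′ {a′ b′} c″ {a″ b″} → a ≈ b → a′ ≈ b′ → a″ ≈ b″ →
           x ≈ y + c * (a - b) + c′ * (a′ - b′) + c″ * (a″ - b″) → x ≈ y
combine₃ c c′ c″ p p′ p″ e = combine₂ c c′ p p′ (combine₁ c″ p″ e)

combine₄ : ∀ {x y} c {a b} c′ {a′ b′} c″ {a″ b″} c‴ {a‴ b‴} → a ≈ b → a′ ≈ b′ → a″ ≈ b″ → a‴ ≈ b‴ →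
           x ≈ y + c * (a - b) + c′ * (a′ - b′) + c″ * (a″ - b″) + c‴ * (a‴ - b‴) → x ≈ y
combine₄ c c′ c″ c‴ p p′ p″ p‴ e = combine₃ c c′ c″ p p′ p″ (combine₁ c‴ p‴ e)

-- q-hypergeometric series

infix 9 q^_

q^_ : ℕ → Series
q^ zero  = 𝟏
q^ suc n = q * q^ n

-- Stands in for division by a series with constant term 1: the difference D of x and y satisfies D
-- = q v D, a contraction over one index.
𝟏-q-cancel : ∀ v {x y} → (𝟏 - q * v) * x ≈ (𝟏 - q * v) * y → x ≈ y
𝟏-q-cancel v {x} {y} p = x-y≈𝟎⇒x≈y
  (Contraction.vanish {I = ⊤} id (λ _ → v) (λ _ → 𝟎) (λ _ → x - y)
    (λ _ → combine₁ 𝟏 p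
      (solve 4 (λ q v x y → x :- y := q :* (v :* (x :- y) :+ con 0ℤ :* (x :- y))
          :+ con 1ℤ :* ((con 1ℤ :- q :* v) :* x :- (con 1ℤ :- q :* v) :* y)) refl q v x y)) tt)

:1 :2 : ∀ {n} → Polynomial n
:1 = con 1ℤ
:2 = con (+ 2)

diagonal : ℕ × ℕ → ℕ × ℕ
diagonal (a , b) = suc a , suc b

-- gauss a b = Σₙ q^((b+1)n + n(n−1)/2) (−q^a; q)ₙ / ((q^(a+1); q)ₙ (q^(b+1); q)ₙ)
gauss : ℕ → ℕ → Series
gauss a b = Contraction.solution diagonal
  (λ (a , b) → q^ a + q^ b - q * (q^ a * q^ b)) (λ (a , b) → q^ b * (𝟏 + q^ a))
  (λ (a , b) → (𝟏 - q^ suc a) * (𝟏 - q^ suc b)) (a , b)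

gauss-rec : ∀ a b → (𝟏 - q^ suc a) * (𝟏 - q^ suc b) * gauss a b ≈
  (𝟏 - q^ suc a) * (𝟏 - q^ suc b) + q^ suc b * (𝟏 + q^ a) * gauss (suc a) (suc b)
gauss-rec a b = combine₁ 𝟏 (Contraction.solution-eq _ _ _ _ (a , b))
  (solve 5 (λ Q A B N N′ → (:1 :- Q :* A) :* (:1 :- Q :* B) :* N :=
     (:1 :- Q :* A) :* (:1 :- Q :* B) :+ Q :* B :* (:1 :+ A) :* N′ :+
     :1 :* (N :- ((:1 :- Q :* A) :* (:1 :- Q :* B)
        :+ Q :* ((A :+ B :- Q :* (A :* B)) :* N :+ B :* (:1 :+ A) :* N′))))
   refl q (q^ a) (q^ b) (gauss a b) (gauss (suc a) (suc b)))

-- A contiguous relation that moves b alone. At a = 0 the inhomogeneous term vanishes, which leaves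
-- the product recurrence `tailProduct-rec`.
gauss-shift : ∀ a b → (𝟏 - q^ suc b) * gauss a b ≈
  (𝟏 - q^ a) * (𝟏 - q^ suc b) + (q^ suc b + q^ a) * gauss a (suc b)
gauss-shift a b = x-y≈𝟎⇒x≈y (Contraction.vanish diagonal
  (λ (a , b) → q^ a + q^ suc b - q * (q^ a * q^ suc b)) (λ (a , b) → q^ b * (𝟏 + q^ a))
  (λ (a , b) → (𝟏 - q^ suc b) * gauss a b -
     ((𝟏 - q^ a) * (𝟏 - q^ suc b) + (q^ suc b + q^ a) * gauss a (suc b)))
  (λ (a , b) → combine₂ (𝟏 - q^ suc (suc b)) (- (q^ suc b + q^ a)) (gauss-rec a b) (gauss-rec a (suc b))
    (solve 7 (λ Q A B N N⁺ N′ N″ →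
      let D  = (:1 :- Q :* B) :* N :- ((:1 :- A) :* (:1 :- Q :* B) :+ (Q :* B :+ A) :* N⁺)
          D′ = (:1 :- Q :* (Q :* B)) :* N′ :-
               ((:1 :- Q :* A) :* (:1 :- Q :* (Q :* B)) :+ (Q :* (Q :* B) :+ Q :* A) :* N″)
      in D := Q :* ((A :+ Q :* B :- Q :* (A :* (Q :* B))) :* D :+ B :* (:1 :+ A) :* D′)
        :+ (:1 :- Q :* (Q :* B)) :* ((:1 :- Q :* A) :* (:1 :- Q :* B) :* N :-
             ((:1 :- Q :* A) :* (:1 :- Q :* B) :+ Q :* B :* (:1 :+ A) :* N′))
        :+ (:- (Q :* B :+ A)) :* ((:1 :- Q :* A) :* (:1 :- Q :* (Q :* B)) :* N⁺ :-
             ((:1 :- Q :* A) :* (:1 :- Q :* (Q :* B)) :+ Q :* (Q :* B) :* (:1 :+ A) :* N″)))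
     refl q (q^ a) (q^ b) (gauss a b) (gauss a (suc b)) (gauss (suc a) (suc b)) (gauss (suc a) (suc (suc b)))))
  (a , b))

-- heine a b = Σₙ q^((b+1)n + n(n−1)/2) (−q^(a+1); q)ₙ / ((q^(a+1); q)ₙ (q^(b+1); q)ₙ)
heine : ℕ → ℕ → Series
heine a b = Contraction.solution diagonal
  (λ (a , b) → q^ a + q^ b - q * (q^ a * q^ b)) (λ (a , b) → q^ b * (𝟏 + q^ suc a))
  (λ (a , b) → (𝟏 - q^ suc a) * (𝟏 - q^ suc b)) (a , b)

heine-rec : ∀ a b → (𝟏 - q^ suc a) * (𝟏 - q^ suc b) * heine a b ≈
  (𝟏 - q^ suc a) * (𝟏 - q^ suc b) + q^ suc b * (𝟏 + q^ suc a) * heine (suc a) (suc b)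
heine-rec a b = combine₁ 𝟏 (Contraction.solution-eq _ _ _ _ (a , b))
  (solve 5 (λ Q A B N N′ → (:1 :- Q :* A) :* (:1 :- Q :* B) :* N :=
     (:1 :- Q :* A) :* (:1 :- Q :* B) :+ Q :* B :* (:1 :+ Q :* A) :* N′ :+
     :1 :* (N :- ((:1 :- Q :* A) :* (:1 :- Q :* B)
        :+ Q :* ((A :+ B :- Q :* (A :* B)) :* N :+ B :* (:1 :+ Q :* A) :* N′))))
   refl q (q^ a) (q^ b) (heine a b) (heine (suc a) (suc b)))

-- At a = 0 the right side is that of `gauss-rec 0 b`, because 1 + q^0 = 2; cancelling 1 - q then
-- gives `heine-tailProduct`.
heine-gauss : ∀ a b →
  (𝟏 - q^ suc a) * ((𝟏 - q^ suc b) * heine a b + q^ suc b * heine a (suc b)) ≈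
  (𝟏 - q^ suc a) * (𝟏 - q^ suc b) + 𝟐 * q^ suc b * gauss (suc a) (suc b)
heine-gauss a b = x-y≈𝟎⇒x≈y (Contraction.vanish diagonal
  (λ (a , b) → q^ suc a + q^ suc b - q * (q^ suc a * q^ suc b)) (λ (a , b) → q^ b * (𝟏 + q^ suc a))
  (λ (a , b) → (𝟏 - q^ suc a) * ((𝟏 - q^ suc b) * heine a b + q^ suc b * heine a (suc b)) -
     ((𝟏 - q^ suc a) * (𝟏 - q^ suc b) + 𝟐 * q^ suc b * gauss (suc a) (suc b)))
  (λ (a , b) → combine₃
    ((𝟏 - q^ suc (suc a)) * (𝟏 - q^ suc (suc b))) (q^ suc b * (𝟏 - q^ suc (suc a))) (- (𝟐 * q^ suc b))
    (heine-rec a b) (heine-rec a (suc b)) (gauss-rec (suc a) (suc b))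
    (solve 9 (λ Q A B U U⁺ U′ U″ N N′ →
      let QA = Q :* A ; QQA = Q :* QA ; QB = Q :* B ; QQB = Q :* QB
          D  = (:1 :- QA) :* ((:1 :- QB) :* U :+ QB :* U⁺) :-
               ((:1 :- QA) :* (:1 :- QB) :+ :2 :* QB :* N)
          D′ = (:1 :- QQA) :* ((:1 :- QQB) :* U′ :+ QQB :* U″) :-
               ((:1 :- QQA) :* (:1 :- QQB) :+ :2 :* QQB :* N′)
      in D := Q :* ((QA :+ QB :- Q :* (QA :* QB)) :* D :+ B :* (:1 :+ QA) :* D′)
        :+ (:1 :- QQA) :* (:1 :- QQB) :* ((:1 :- QA) :* (:1 :- QB) :* U :-
             ((:1 :- QA) :* (:1 :- QB) :+ QB :* (:1 :+ QA) :* U′))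
        :+ QB :* (:1 :- QQA) :* ((:1 :- QA) :* (:1 :- QQB) :* U⁺ :-
             ((:1 :- QA) :* (:1 :- QQB) :+ QQB :* (:1 :+ QA) :* U″))
        :+ (:- (:2 :* QB)) :* ((:1 :- QQA) :* (:1 :- QQB) :* N :-
             ((:1 :- QQA) :* (:1 :- QQB) :+ QQB :* (:1 :+ QA) :* N′)))
     refl q (q^ a) (q^ b) (heine a b) (heine a (suc b)) (heine (suc a) (suc b))
       (heine (suc a) (suc (suc b))) (gauss (suc a) (suc b)) (gauss (suc (suc a)) (suc (suc b)))))
  (a , b))

-- tailProduct b = Π_{i > b} (1 + q^i) / (1 − q^i), by the q-Gauss sum: see tailProduct-rec and tailProduct-congruent-𝟏.
tailProduct : ℕ → Series
tailProduct = gauss 0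

tailProduct-rec : ∀ b → (𝟏 - q^ suc b) * tailProduct b ≈ (𝟏 + q^ suc b) * tailProduct (suc b)
tailProduct-rec b = combine₁ 𝟏 (gauss-shift 0 b)
  (solve 3 (λ QB N N⁺ → (:1 :- QB) :* N := (:1 :+ QB) :* N⁺ :+ :1 :* ((:1 :- QB) :* N :-
     ((:1 :- :1) :* (:1 :- QB) :+ (QB :+ :1) :* N⁺)))
   refl (q^ suc b) (tailProduct b) (tailProduct (suc b)))

heine-tailProduct : ∀ b → (𝟏 - q^ suc b) * heine 0 b + q^ suc b * heine 0 (suc b) ≈ (𝟏 - q^ suc b) * tailProduct b
heine-tailProduct b = 𝟏-q-cancel 𝟏 (combine₂ 𝟏 (- 𝟏) (heine-gauss 0 b) (gauss-rec 0 b)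
  (solve 6 (λ Q QB U U⁺ N N′ →
      (:1 :- Q :* :1) :* ((:1 :- QB) :* U :+ QB :* U⁺) := (:1 :- Q :* :1) :* ((:1 :- QB) :* N)
      :+ :1 :* ((:1 :- Q :* :1) :* ((:1 :- QB) :* U :+ QB :* U⁺) :-
           ((:1 :- Q :* :1) :* (:1 :- QB) :+ :2 :* QB :* N′))
      :+ (:- :1) :* ((:1 :- Q :* :1) :* (:1 :- QB) :* N :-
           ((:1 :- Q :* :1) :* (:1 :- QB) :+ QB :* (:1 :+ :1) :* N′)))
   refl q (q^ suc b) (heine 0 b) (heine 0 (suc b)) (tailProduct b) (gauss 1 (suc b))))

-- fine a b = Σₙ (−1)ⁿ q^((b+1)n + n(n−1)/2) / (−q^(a+1); q)ₙ
fine : ℕ → ℕ → Series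
fine a b = Contraction.solution diagonal (λ (a , b) → - q^ a) (λ (a , b) → - q^ b)
  (λ (a , b) → 𝟏 + q^ suc a) (a , b)

fine-rec : ∀ a b → (𝟏 + q^ suc a) * fine a b ≈ 𝟏 + q^ suc a - q^ suc b * fine (suc a) (suc b)
fine-rec a b = combine₁ 𝟏 (Contraction.solution-eq _ _ _ _ (a , b))
  (solve 5 (λ Q A B F F′ → (:1 :+ Q :* A) :* F := :1 :+ Q :* A :- Q :* B :* F′
      :+ :1 :* (F :- (:1 :+ Q :* A :+ Q :* ((:- A) :* F :+ (:- B) :* F′))))
   refl q (q^ a) (q^ b) (fine a b) (fine (suc a) (suc b)))

-- Both sides solve (1 - q^(b+1)) X b + q^(b+1) X (b+1) = (1 - q^(b+1)) `tailProduct b`.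
heine-fine : ∀ b → heine 0 b ≈ tailProduct b * fine b b
heine-fine b = x-y≈𝟎⇒x≈y (Contraction.vanish suc q^_ (λ b → - q^ b)
  (λ b → heine 0 b - tailProduct b * fine b b)
  (λ b → combine₃ 𝟏 (𝟏 - fine b b) (- tailProduct (suc b)) (heine-tailProduct b) (tailProduct-rec b) (fine-rec b b)
    (solve 8 (λ Q B U U⁺ P P⁺ F F⁺ →
      let QB = Q :* B in
      U :- P :* F := Q :* (B :* (U :- P :* F) :+ (:- B) :* (U⁺ :- P⁺ :* F⁺))
        :+ :1 :* ((:1 :- QB) :* U :+ QB :* U⁺ :- (:1 :- QB) :* P)
        :+ (:1 :- F) :* ((:1 :- QB) :* P :- (:1 :+ QB) :* P⁺)
        :+ (:- P⁺) :* ((:1 :+ QB) :* F :- (:1 :+ QB :- QB :* F⁺)))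
     refl q (q^ b) (heine 0 b) (heine 0 (suc b)) (tailProduct b) (tailProduct (suc b)) (fine b b)
       (fine (suc b) (suc b)))) b)

-- Moves b alone; together with the diagonal `fine-rec` it reaches the line of slope 2 on which
-- `falseTheta` lives.
fine-shift : ∀ a b → fine a b ≈ 𝟏 + q^ a - (q^ a + q^ suc b) * fine a (suc b)
fine-shift a b = x-y≈𝟎⇒x≈y (Contraction.vanish diagonal (λ (a , b) → - q^ a) (λ (a , b) → - q^ b)
  (λ (a , b) → fine a b - (𝟏 + q^ a - (q^ a + q^ suc b) * fine a (suc b)))
  (λ (a , b) → combine₂ 𝟏 (q^ a + q^ suc b) (fine-rec a b) (fine-rec a (suc b))
    (solve 7 (λ Q A B F F⁺ F′ F″ →
      let QA = Q :* A ; QB = Q :* B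
          D  = F :- (:1 :+ A :- (A :+ QB) :* F⁺)
          D′ = F′ :- (:1 :+ QA :- (QA :+ Q :* QB) :* F″)
      in D := Q :* ((:- A) :* D :+ (:- B) :* D′)
        :+ :1 :* ((:1 :+ QA) :* F :- (:1 :+ QA :- QB :* F′))
        :+ (A :+ QB) :* ((:1 :+ QA) :* F⁺ :- (:1 :+ QA :- Q :* QB :* F″)))
     refl q (q^ a) (q^ b) (fine a b) (fine a (suc b)) (fine (suc a) (suc b)) (fine (suc a) (suc (suc b)))))
  (a , b))

double : ℕ → ℕ
double zero    = zero
double (suc n) = suc (suc (double n))

q^double : ∀ n → q^ double n ≈ q^ n * q^ n
q^double zero    = solve 0 (:1 := :1 :* :1) refl
q^double (suc n) = combine₁ (q * q) (q^double n)
  (solve 3 (λ Q D A → Q :* (Q :* D) := Q :* A :* (Q :* A) :+ Q :* Q :* (D :- A :* A))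
   refl q (q^ double n) (q^ n))

falseTheta : ℕ → Series
falseTheta j = fine j (double j)

-- One diagonal step and one step in b lead from (j, 2j) to (j+1, 2j+2). On this line the
-- coefficient q^(j+1) + q^(2j+2) in `fine-shift` equals q^(j+1) (1 + q^(j+1)), so the factor 1 +
-- q^(j+1) cancels throughout and no denominator survives.
falseTheta-rec : ∀ j → falseTheta j ≈
  𝟏 - q^ suc (double j) + q^ suc (suc (double j)) * q^ j * falseTheta (suc j)
falseTheta-rec j = 𝟏-q-cancel (- q^ j) (combine₃ 𝟏 (- q^ suc (double j))
    (q * q^ double j * (q * q) * fine (suc j) (suc (suc (double j))))
    (fine-rec j (double j)) (fine-shift (suc j) (suc (double j))) (q^double j)
  (solve 6 (λ Q A B F F′ F″ →
      let QA = Q :* A ; QB = Q :* B in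
      (:1 :- Q :* (:- A)) :* F := (:1 :- Q :* (:- A)) :* (:1 :- QB :+ Q :* QB :* A :* F″)
      :+ :1 :* ((:1 :+ QA) :* F :- (:1 :+ QA :- QB :* F′))
      :+ (:- QB) :* (F′ :- (:1 :+ QA :- (QA :+ Q :* (Q :* B)) :* F″))
      :+ (QB :* (Q :* Q) :* F″) :* (B :- A :* A))
   refl q (q^ j) (q^ double j) (falseTheta j) (fine (suc j) (suc (double j)))
     (fine (suc j) (suc (suc (double j))))))

-- The symmetric form of the alternating series

skip₂ : ℕ × ℕ → ℕ × ℕ
skip₂ (a , b) = suc (suc a) , b

-- symFine a b = Σₙ (−1)ⁿ q^((b+1)n) / (−q^(a+1); q²)ₙ₊₁, which turns out to be symmetric in a and b.
symFine : ℕ → ℕ → Series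
symFine a b = Contraction.solution skip₂ (λ (a , b) → - q^ a) (λ (a , b) → - q^ b) (λ _ → 𝟏) (a , b)

symFine-rec : ∀ a b → (𝟏 + q^ suc a) * symFine a b ≈ 𝟏 - q^ suc b * symFine (suc (suc a)) b
symFine-rec a b = combine₁ 𝟏 (Contraction.solution-eq _ _ _ _ (a , b))
  (solve 5 (λ Q A B F F′ → (:1 :+ Q :* A) :* F := :1 :- Q :* B :* F′
      :+ :1 :* (F :- (:1 :+ Q :* ((:- A) :* F :+ (:- B) :* F′))))
   refl q (q^ a) (q^ b) (symFine a b) (symFine (suc (suc a)) b))

-- The symmetry in the form in which it is used: `symFine-rec` with a and b exchanged. It makes the
-- second parameter movable, which the defining recurrence keeps fixed.
symFine-recʳ : ∀ a b → (𝟏 + q^ suc b) * symFine a b ≈ 𝟏 - q^ suc a * symFine a (suc (suc b))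
symFine-recʳ a b = x-y≈𝟎⇒x≈y (Contraction.vanish skip₂ (λ (a , b) → - q^ a) (λ (a , b) → - q^ b)
  (λ (a , b) → (𝟏 + q^ suc b) * symFine a b - (𝟏 - q^ suc a * symFine a (suc (suc b))))
  (λ (a , b) → combine₂ (𝟏 + q^ suc b) (q^ suc a) (symFine-rec a b) (symFine-rec a (suc (suc b)))
    (solve 7 (λ Q A B F F⁺ F′ F″ →
      let QA = Q :* A ; QB = Q :* B
          D  = (:1 :+ QB) :* F :- (:1 :- QA :* F⁺)
          D′ = (:1 :+ QB) :* F′ :- (:1 :- Q :* (Q :* QA) :* F″)
      in D := Q :* ((:- A) :* D :+ (:- B) :* D′)
        :+ (:1 :+ QB) :* ((:1 :+ QA) :* F :- (:1 :- QB :* F′))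
        :+ QA :* ((:1 :+ QA) :* F⁺ :- (:1 :- Q :* (Q :* QB) :* F″)))
     refl q (q^ a) (q^ b) (symFine a b) (symFine a (suc (suc b))) (symFine (suc (suc a)) b)
       (symFine (suc (suc a)) (suc (suc b)))))
  (a , b))

-- Two diagonal steps of `fine`, against one step of `symFine` in each parameter. Either way Y a
-- satisfies (1 + q^(a+2)) (1 + q^(a+3)) Y a = 1 + q^(a+3) + q^(2a+5) Y (a+2).
fine-symFine : ∀ a → fine (suc a) (suc a) ≈ (𝟏 + q^ suc a) * symFine a (suc a)
fine-symFine a = x-y≈𝟎⇒x≈y (Contraction.vanish (λ a → suc (suc a))
  -- This is the v with 1 - q v = (1 + q^(a+2)) (1 + q^(a+3)).
  (λ a → - (q * q^ a + q * (q * q^ a) + q * (q * (q * (q * (q^ a * q^ a))))))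
  (λ a → q * (q * (q * (q * (q^ a * q^ a)))))
  (λ a → fine (suc a) (suc a) - (𝟏 + q^ suc a) * symFine a (suc a))
  (λ a → combine₄ (𝟏 + q^ suc (suc (suc a))) (- ((𝟏 + q^ suc (suc a)) * (𝟏 + q^ suc (suc (suc a)))))
      (q^ suc (suc a) * (𝟏 + q^ suc (suc (suc a)))) (- q^ suc (suc a))
      (fine-rec (suc a) (suc a)) (symFine-rec a (suc a))
      (symFine-recʳ (suc (suc a)) (suc a)) (fine-rec (suc (suc a)) (suc (suc a)))
    (solve 8 (λ Q A F₁ F₂ F₃ S₁ S₂ S₃ →
      let A₁ = Q :* A ; A₂ = Q :* A₁ ; A₃ = Q :* A₂ ; Q⁴A² = Q :* (Q :* (Q :* (Q :* (A :* A))))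
          D = F₁ :- (:1 :+ A₁) :* S₁ ; D′ = F₃ :- (:1 :+ A₃) :* S₃
      in D := Q :* ((:- (A₁ :+ A₂ :+ Q⁴A²)) :* D :+ Q⁴A² :* D′)
        :+ (:1 :+ A₃) :* ((:1 :+ A₂) :* F₁ :- (:1 :+ A₂ :- A₂ :* F₂))
        :+ (:- ((:1 :+ A₂) :* (:1 :+ A₃))) :* ((:1 :+ A₁) :* S₁ :- (:1 :- A₂ :* S₂))
        :+ A₂ :* (:1 :+ A₃) :* ((:1 :+ A₂) :* S₂ :- (:1 :- A₃ :* S₃))
        :+ (:- A₂) :* ((:1 :+ A₃) :* F₂ :- (:1 :+ A₃ :- A₃ :* F₃)))
     refl q (q^ a) (fine (suc a) (suc a)) (fine (suc (suc a)) (suc (suc a)))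
       (fine (suc (suc (suc a))) (suc (suc (suc a)))) (symFine a (suc a)) (symFine (suc (suc a)) (suc a))
       (symFine (suc (suc a)) (suc (suc (suc a)))))) a)

-- The Abel sum 2 Σₙ (-1)ⁿ / (-q^(a+1); q²)ₙ₊₁, rewritten with convergent terms.
oddTail : ℕ → Series
oddTail a = 𝟏 - q^ suc a * symFine a 1

oddTail-rec : ∀ a → (𝟏 + q^ suc a) * oddTail a ≈ 𝟐 - oddTail (suc (suc a))
oddTail-rec a = combine₁ (- q^ suc a) (symFine-rec a 1)
  (solve 4 (λ Q A F F′ → let QA = Q :* A ; QQ = Q :* (Q :* :1) in
     (:1 :+ QA) :* (:1 :- QA :* F) := :2 :- (:1 :- Q :* (Q :* QA) :* F′)
     :+ (:- QA) :* ((:1 :+ QA) :* F :- (:1 :- QQ :* F′)))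
   refl q (q^ a) (symFine a 1) (symFine (suc (suc a)) 1))

fine-oddTail : fine 0 0 ≈ oddTail 0
fine-oddTail = 𝟏-q-cancel (- 𝟏) (combine₂ 𝟏 (- (q * 𝟏)) (fine-rec 0 0) (fine-symFine 0)
  (solve 4 (λ Q F F′ S → let Q1 = Q :* :1 in
     (:1 :- Q :* (:- :1)) :* F := (:1 :- Q :* (:- :1)) :* (:1 :- Q1 :* S)
     :+ :1 :* ((:1 :+ Q1) :* F :- (:1 :+ Q1 :- Q1 :* F′))
     :+ (:- Q1) :* (F′ :- (:1 :+ Q1) :* S))
   refl q (fine 0 0) (fine 1 1) (symFine 0 1)))

-- Generating functions of weighted partitions

-- geom i Y = Σₖ q^((i+1)k) Yₖ
geom : ℕ → (ℕ → Series) → Series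
-- The indices of the contraction are the sequences Y themselves, and `σ` drops the leading term.
geom i = Contraction.solution (_∘ suc) (λ _ → 𝟎) (λ _ → q^ i) (λ Y → Y 0)

geom-rec : ∀ i Y → geom i Y ≈ Y 0 + q^ suc i * geom i (Y ∘ suc)
geom-rec i Y = trans (Contraction.solution-eq _ _ _ _ Y)
  (solve 5 (λ Q I Y₀ G G′ → Y₀ :+ Q :* (con 0ℤ :* G :+ I :* G′) := Y₀ :+ Q :* I :* G′)
    refl q (q^ i) (Y 0) (geom i Y) (geom i (Y ∘ suc)))

-- Pointwise equal sequences are still distinct indices, so the contraction runs over pairs of
-- sequences bundled with a proof that they agree.
geom-cong : ∀ i {Y Z} → (∀ k → Y k ≈ Z k) → geom i Y ≈ geom i Z
geom-cong i {Y} {Z} p = x-y≈𝟎⇒x≈y (Contraction.vanish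
  {I = Σ[ YZ ∈ (ℕ → Series) × (ℕ → Series) ] (∀ k → proj₁ YZ k ≈ proj₂ YZ k)}
  (λ ((Y , Z) , p) → (Y ∘ suc , Z ∘ suc) , p ∘ suc) (λ _ → 𝟎) (λ _ → q^ i)
  (λ ((Y , Z) , _) → geom i Y - geom i Z)
  (λ ((Y , Z) , p) → combine₃ 𝟏 (- 𝟏) 𝟏 (geom-rec i Y) (geom-rec i Z) (p 0)
    (solve 8 (λ Q I Y₀ Z₀ G G′ H H′ → G :- H :=
       Q :* (con 0ℤ :* (G :- H) :+ I :* (G′ :- H′))
       :+ :1 :* (G :- (Y₀ :+ Q :* I :* G′)) :+ (:- :1) :* (H :- (Z₀ :+ Q :* I :* H′)) :+ :1 :* (Y₀ :- Z₀))
     refl q (q^ i) (Y 0) (Z 0) (geom i Y) (geom i (Y ∘ suc)) (geom i Z) (geom i (Z ∘ suc))))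
  ((Y , Z) , p))

geom-+ : ∀ i Y Z → geom i (λ k → Y k + Z k) ≈ geom i Y + geom i Z
geom-+ i Y Z = x-y≈𝟎⇒x≈y (Contraction.vanish
  (λ (Y , Z) → Y ∘ suc , Z ∘ suc) (λ _ → 𝟎) (λ _ → q^ i)
  (λ (Y , Z) → geom i (λ k → Y k + Z k) - (geom i Y + geom i Z))
  (λ (Y , Z) → combine₃ 𝟏 (- 𝟏) (- 𝟏) (geom-rec i (λ k → Y k + Z k)) (geom-rec i Y) (geom-rec i Z)
    (solve 10 (λ Q I Y₀ Z₀ K K′ G G′ H H′ → K :- (G :+ H) :=
       Q :* (con 0ℤ :* (K :- (G :+ H)) :+ I :* (K′ :- (G′ :+ H′)))
       :+ :1 :* (K :- (Y₀ :+ Z₀ :+ Q :* I :* K′))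
       :+ (:- :1) :* (G :- (Y₀ :+ Q :* I :* G′)) :+ (:- :1) :* (H :- (Z₀ :+ Q :* I :* H′)))
     refl q (q^ i) (Y 0) (Z 0) (geom i (λ k → Y k + Z k)) (geom i (λ k → Y (suc k) + Z (suc k)))
       (geom i Y) (geom i (Y ∘ suc)) (geom i Z) (geom i (Z ∘ suc))))
  (Y , Z))

geom-* : ∀ i c Y → geom i (λ k → c * Y k) ≈ c * geom i Y
geom-* i c Y = x-y≈𝟎⇒x≈y (Contraction.vanish
  (_∘ suc) (λ _ → 𝟎) (λ _ → q^ i)
  (λ Y → geom i (λ k → c * Y k) - c * geom i Y)
  (λ Y → combine₂ 𝟏 (- c) (geom-rec i (λ k → c * Y k)) (geom-rec i Y)
    (solve 8 (λ Q I C Y₀ K K′ G G′ → K :- C :* G :=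
       Q :* (con 0ℤ :* (K :- C :* G) :+ I :* (K′ :- C :* G′))
       :+ :1 :* (K :- (C :* Y₀ :+ Q :* I :* K′))
       :+ (:- C) :* (G :- (Y₀ :+ Q :* I :* G′)))
     refl q (q^ i) c (Y 0) (geom i (λ k → c * Y k)) (geom i (λ k → c * Y (suc k)))
       (geom i Y) (geom i (Y ∘ suc))))
  Y)

geom-q^ : ∀ i Y → geom i (λ k → q^ k * Y k) ≈ geom (suc i) Y
geom-q^ i Y = x-y≈𝟎⇒x≈y (Contraction.vanish
  (_∘ suc) (λ _ → 𝟎) (λ _ → q^ suc i)
  (λ Y → geom i (λ k → q^ k * Y k) - geom (suc i) Y)
  (λ Y → combine₃ 𝟏 (q^ suc i) (- 𝟏) (geom-rec i (λ k → q^ k * Y k))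
    (trans (geom-cong i (λ k → *-assoc q (q^ k) (Y (suc k)))) (geom-* i q (λ k → q^ k * Y (suc k))))
    (geom-rec (suc i) Y)
    (solve 8 (λ Q I Y₀ K K″ K′ G G′ → K :- G :=
       Q :* (con 0ℤ :* (K :- G) :+ Q :* I :* (K′ :- G′))
       :+ :1 :* (K :- (:1 :* Y₀ :+ Q :* I :* K″)) :+ Q :* I :* (K″ :- Q :* K′)
       :+ (:- :1) :* (G :- (Y₀ :+ Q :* (Q :* I) :* G′)))
     refl q (q^ i) (Y 0) (geom i (λ k → q^ k * Y k)) (geom i (λ k → q^ suc k * Y (suc k)))
       (geom i (λ k → q^ k * Y (suc k))) (geom (suc i) Y) (geom (suc i) (Y ∘ suc))))
  Y)

geom-constant : ∀ i y → (𝟏 - q^ suc i) * geom i (λ _ → y) ≈ y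
geom-constant i y = combine₁ 𝟏 (geom-rec i (λ _ → y))
  (solve 3 (λ X y G → (:1 :- X) :* G := y :+ :1 :* (G :- (y :+ X :* G)))
    refl (q^ suc i) y (geom i (λ _ → y)))

-- Finite sums of integers and of series

∑-cong : ∀ {A : Set} (xs : List A) {f g : A → ℤ} → f ≗ g → ∑ xs f ≡ ∑ xs g
∑-cong []       p = ≡.refl
∑-cong (x ∷ xs) p = cong₂ ℤ._+_ (p x) (∑-cong xs p)

∑-++ : ∀ {A : Set} (xs ys : List A) f → ∑ (xs ++ ys) f ≡ ∑ xs f ℤ.+ ∑ ys f
∑-++ []       ys f = ≡.sym (ℤ.+-identityˡ _)
∑-++ (x ∷ xs) ys f = ≡.trans (cong (ℤ._+_ (f x)) (∑-++ xs ys f)) (≡.sym (ℤ.+-assoc (f x) _ _))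

∑-map : ∀ {A B : Set} (g : A → B) xs f → ∑ (map g xs) f ≡ ∑ xs (f ∘ g)
∑-map g []       f = ≡.refl
∑-map g (x ∷ xs) f = cong (ℤ._+_ (f (g x))) (∑-map g xs f)

∑-concatMap : ∀ {A B : Set} (g : A → List B) xs f → ∑ (concatMap g xs) f ≡ ∑ xs (λ x → ∑ (g x) f)
∑-concatMap g []       f = ≡.refl
∑-concatMap g (x ∷ xs) f =
  ≡.trans (∑-++ (g x) (concatMap g xs) f) (cong (ℤ._+_ (∑ (g x) f)) (∑-concatMap g xs f))

∑-filter : ∀ {A : Set} {P : A → Set} (P? : Decidable P) xs f →
           ∑ (filter P? xs) f ≡ ∑ xs (λ x → if does (P? x) then f x else 0ℤ)
∑-filter P? []       f = ≡.refl
∑-filter P? (x ∷ xs) f with does (P? x)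
... | true  = cong (ℤ._+_ (f x)) (∑-filter P? xs f)
... | false = ≡.trans (∑-filter P? xs f) (≡.sym (ℤ.+-identityˡ _))

∑-+ : ∀ {A : Set} (xs : List A) f g → ∑ xs (λ x → f x ℤ.+ g x) ≡ ∑ xs f ℤ.+ ∑ xs g
∑-+ []       f g = ≡.refl
∑-+ (x ∷ xs) f g = ≡.trans (cong (ℤ._+_ (f x ℤ.+ g x)) (∑-+ xs f g))
  (exchange (f x) (g x) (∑ xs f) (∑ xs g))
  where
  exchange : ∀ a b c d → a ℤ.+ b ℤ.+ (c ℤ.+ d) ≡ a ℤ.+ c ℤ.+ (b ℤ.+ d)
  exchange = solve-∀

∑-*ˡ : ∀ {A : Set} (xs : List A) c f → ∑ xs (λ x → c ℤ.* f x) ≡ c ℤ.* ∑ xs f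
∑-*ˡ []       c f = ≡.sym (ℤ.*-zeroʳ c)
∑-*ˡ (x ∷ xs) c f = ≡.trans (cong (ℤ._+_ (c ℤ.* f x)) (∑-*ˡ xs c f)) (≡.sym (ℤ.*-distribˡ-+ c (f x) (∑ xs f)))

∑-zero : ∀ {A : Set} (xs : List A) → ∑ xs (λ _ → 0ℤ) ≡ 0ℤ
∑-zero []       = ≡.refl
∑-zero (x ∷ xs) = ≡.trans (ℤ.+-identityˡ _) (∑-zero xs)

∑-swap : ∀ {A B : Set} (xs : List A) (ys : List B) (f : A → B → ℤ) →
         ∑ xs (λ x → ∑ ys (f x)) ≡ ∑ ys (λ y → ∑ xs (λ x → f x y))
∑-swap []       ys f = ≡.sym (∑-zero ys)
∑-swap (x ∷ xs) ys f = ≡.trans (cong (ℤ._+_ (∑ ys (f x))) (∑-swap xs ys f))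
  (≡.sym (∑-+ ys (f x) (λ y → ∑ xs (λ x → f x y))))

∑ˢ : {A : Set} → List A → (A → Series) → Series
∑ˢ xs F = foldr (λ x s → F x + s) 𝟎 xs

coeff-∑ˢ : ∀ {A : Set} (xs : List A) F n → coeff (∑ˢ xs F) n ≡ ∑ xs (λ x → coeff (F x) n)
coeff-∑ˢ []       F n = coeff-𝟎 n
coeff-∑ˢ (x ∷ xs) F n = ≡.trans (coeff-+ (F x) (∑ˢ xs F) n) (cong (ℤ._+_ (coeff (F x) n)) (coeff-∑ˢ xs F n))

∑ˢ-cong : ∀ {A : Set} (xs : List A) {F G : A → Series} → (∀ x → F x ≈ G x) → ∑ˢ xs F ≈ ∑ˢ xs G
∑ˢ-cong []       p = refl
∑ˢ-cong (x ∷ xs) p = +-cong (p x) (∑ˢ-cong xs p)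

∑ˢ-*ˡ : ∀ {A : Set} (xs : List A) c F → ∑ˢ xs (λ x → c * F x) ≈ c * ∑ˢ xs F
∑ˢ-*ˡ []       c F = solve 1 (λ c → con 0ℤ := c :* con 0ℤ) refl c
∑ˢ-*ˡ (x ∷ xs) c F = trans (+-congˡ (∑ˢ-*ˡ xs c F))
  (solve 3 (λ c f s → c :* f :+ c :* s := c :* (f :+ s)) refl c (F x) (∑ˢ xs F))

∑ˢ-map : ∀ {A B : Set} (g : A → B) xs F → ∑ˢ (map g xs) F ≡ ∑ˢ xs (F ∘ g)
∑ˢ-map g []       F = ≡.refl
∑ˢ-map g (x ∷ xs) F = cong (_+_ (F (g x))) (∑ˢ-map g xs F)

q^-+ : ∀ a b → q^ (a ℕ.+ b) ≈ q^ a * q^ b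
q^-+ zero    b = solve 1 (λ b → b := :1 :* b) refl (q^ b)
q^-+ (suc a) b = trans (*-congˡ (q^-+ a b)) (sym (*-assoc q (q^ a) (q^ b)))

coeff-q^* : ∀ j x n → coeff (q^ j * x) n ≡ (if does (j ≤? n) then coeff x (n ℕ.∸ j) else 0ℤ)
coeff-q^* zero    x n       = coeff-cong (solve 1 (λ x → :1 :* x := x) refl x) n
coeff-q^* (suc j) x zero    =
  ≡.trans (coeff-cong (*-assoc q (q^ j) x) 0) (coeff-q*-zero (q^ j * x))
coeff-q^* (suc j) x (suc n) =
  ≡.trans (coeff-cong (*-assoc q (q^ j) x) (suc n)) (≡.trans (coeff-q*-suc (q^ j * x) n)
    (≡.trans (coeff-q^* j x n) (cong (if_then coeff x (n ℕ.∸ j) else 0ℤ) (lemma j n))))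
  where
  lemma : ∀ j n → does (j ≤? n) ≡ does (suc j ≤? suc n)
  lemma zero    n = ≡.refl
  lemma (suc j) n = ≡.refl

-- The k-th term is divisible by q^k, so terms with k ≥ M are invisible below q^M. Since
-- `partitionsUpTo` tries multiplicities up to n, the case M = n + 1 is the one needed.
geom-partial : ∀ m M Y → ∑ˢ (upTo M) (λ k → q^ (k ℕ.* suc m) * Y k) ≈[ M ] geom m Y
geom-partial m zero    Y _ ()
geom-partial m (suc M) Y = ≈[]-trans (≈⇒≈[] lhs) (≈[]-trans
  (≈[]-+ {Y 0} {Y 0} (≈⇒≈[] refl) (≈[]-q* (≈[]-* (q^ m) (geom-partial m M (Y ∘ suc)))))
  (≈⇒≈[] (trans (+-congˡ (sym (*-assoc q (q^ m) (geom m (Y ∘ suc))))) (sym (geom-rec m Y)))))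
  where
  F : ℕ → Series
  F k = q^ (k ℕ.* suc m) * Y (suc k)
  lhs : ∑ˢ (upTo (suc M)) (λ k → q^ (k ℕ.* suc m) * Y k) ≈ Y 0 + q * (q^ m * ∑ˢ (upTo M) F)
  lhs = +-cong (solve 1 (λ y → :1 :* y := y) refl (Y 0)) (trans
    (reflexive (≡.trans
      (cong (λ ks → ∑ˢ ks (λ k → q^ (k ℕ.* suc m) * Y k)) (≡.sym (map-upTo suc M)))
      (∑ˢ-map suc (upTo M) (λ k → q^ (k ℕ.* suc m) * Y k))))
    (trans (∑ˢ-cong (upTo M) (λ k → trans (*-congʳ (q^-+ (suc m) (k ℕ.* suc m))) (*-assoc (q^ suc m) _ _)))
      (trans (∑ˢ-*ˡ (upTo M) (q^ suc m) F) (*-assoc q (q^ m) (∑ˢ (upTo M) F)))))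

-- Recursion on the largest admissible part

weighted : ℕ → (List ℕ → ℤ) → Series
weighted m W = series (λ n → ∑ (partitionsUpTo m n) W)

-- The multiplicity of the part m + 1 becomes the summation index of `geom`; the filter in
-- `partitionsUpTo` is the case split of `coeff-q^*`.
weighted-suc : ∀ m W → weighted (suc m) W ≈ geom m (λ k → weighted m (W ∘ (replicate k (suc m) ++_)))
weighted-suc m W = coeff-ext (λ n → ≡.trans (coeff-series _ n) (≡.trans (lhs n)
    (≡.trans (≡.sym (coeff-∑ˢ (upTo (suc n)) (λ k → q^ (k ℕ.* suc m) * Y k) n))
      (geom-partial m (suc n) Y n ≤-refl))))
  where
  Y : ℕ → Series
  Y k = weighted m (W ∘ (replicate k (suc m) ++_))
  term : ∀ n k → (if does (k ℕ.* suc m ≤? n)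
                  then ∑ (map (replicate k (suc m) ++_) (partitionsUpTo m (n ℕ.∸ k ℕ.* suc m))) W else 0ℤ)
         ≡ coeff (q^ (k ℕ.* suc m) * Y k) n
  term n k = ≡.trans
    (cong (if does (k ℕ.* suc m ≤? n) then_else 0ℤ)
      (≡.trans (∑-map (replicate k (suc m) ++_) (partitionsUpTo m (n ℕ.∸ k ℕ.* suc m)) W)
               (≡.sym (coeff-series _ (n ℕ.∸ k ℕ.* suc m)))))
    (≡.sym (coeff-q^* (k ℕ.* suc m) (Y k) n))
  lhs : ∀ n → ∑ (partitionsUpTo (suc m) n) W ≡ ∑ (upTo (suc n)) (λ k → coeff (q^ (k ℕ.* suc m) * Y k) n)
  lhs n = ≡.trans (∑-concatMap (λ k → map (replicate k (suc m) ++_) (partitionsUpTo m (n ℕ.∸ k ℕ.* suc m)))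
            (filter (λ k → k ℕ.* suc m ≤? n) (upTo (suc n))) W)
    (≡.trans (∑-filter (λ k → k ℕ.* suc m ≤? n) (upTo (suc n))
      (λ k → ∑ (map (replicate k (suc m) ++_) (partitionsUpTo m (n ℕ.∸ k ℕ.* suc m))) W))
      (∑-cong (upTo (suc n)) (term n)))

q^*≈[]𝟎 : ∀ j x → q^ j * x ≈[ j ] 𝟎
q^*≈[]𝟎 zero    x _ ()
q^*≈[]𝟎 (suc j) x = ≈[]-trans (≈⇒≈[] (*-assoc q (q^ j) x))
  (≈[]-trans (≈[]-q* (q^*≈[]𝟎 j x)) (≈⇒≈[] (solve 1 (λ q → q :* con 0ℤ := con 0ℤ) refl q)))

+q^*-≈[] : ∀ j x y → x + q^ j * y ≈[ j ] x
+q^*-≈[] j x y = ≈[]-trans (≈[]-+ {x} {x} (≈⇒≈[] refl) (q^*≈[]𝟎 j y))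
  (≈⇒≈[] (solve 1 (λ x → x :+ con 0ℤ := x) refl x))

geom-𝟎 : ∀ i → geom i (λ _ → 𝟎) ≈ 𝟎
geom-𝟎 i = 𝟏-q-cancel (q^ i) (trans (geom-constant i 𝟎)
  (solve 1 (λ X → con 0ℤ := (:1 :- X) :* con 0ℤ) refl (q^ suc i)))

geom-two : ∀ i Y → (∀ k → Y (suc (suc k)) ≈ 𝟎) → geom i Y ≈ Y 0 + q^ suc i * Y 1
geom-two i Y p = combine₃ 𝟏 (q^ suc i) (q^ suc i * q^ suc i) (geom-rec i Y) (geom-rec i (Y ∘ suc))
  (trans (geom-cong i p) (geom-𝟎 i))
  (solve 6 (λ X G G′ G″ Y₀ Y₁ → G := Y₀ :+ X :* Y₁ :+ :1 :* (G :- (Y₀ :+ X :* G′))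
      :+ X :* (G′ :- (Y₁ :+ X :* G″)) :+ X :* X :* (G″ :- con 0ℤ))
    refl (q^ suc i) (geom i Y) (geom i (Y ∘ suc)) (geom i (Y ∘ suc ∘ suc)) (Y 0) (Y 1))

weighted-+ : ∀ m W V → weighted m (λ π → W π ℤ.+ V π) ≈ weighted m W + weighted m V
weighted-+ m W V = coeff-ext (λ n → ≡.trans (coeff-series _ n) (≡.trans (∑-+ (partitionsUpTo m n) W V)
  (≡.sym (≡.trans (coeff-+ _ _ n) (cong₂ ℤ._+_ (coeff-series _ n) (coeff-series _ n))))))

weighted-* : ∀ m c W → weighted m (λ π → c ℤ.* W π) ≈ const c * weighted m W
weighted-* m c W = coeff-ext (λ n → ≡.trans (coeff-series _ n) (≡.trans (∑-*ˡ (partitionsUpTo m n) c W)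
  (≡.sym (≡.trans (coeff-const* c _ n) (cong (ℤ._*_ c) (coeff-series _ n))))))

weighted-zero : ∀ W → weighted 0 W ≈ const (W [])
weighted-zero W = coeff-ext λ where
  zero    → ≡.trans (coeff-series _ 0) (≡.trans (ℤ.+-identityʳ (W [])) (≡.sym (coeff-const-zero (W []))))
  (suc n) → ≡.trans (coeff-series _ (suc n)) (≡.sym (coeff-const-suc (W []) n))

All-≤-replicate : ∀ k {m ρ} → All (ℕ._≤ m) ρ → All (ℕ._≤ suc m) (replicate k (suc m) ++ ρ)
All-≤-replicate k ρ≤m = All.++⁺ (All.replicate⁺ k ≤-refl) (All.map m≤n⇒m≤1+n ρ≤m)

weighted-cong : ∀ m {W V} → (∀ π → All (ℕ._≤ m) π → W π ≡ V π) → weighted m W ≈ weighted m V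
weighted-cong zero    {W} {V} p =
  trans (weighted-zero W) (trans (reflexive (cong const (p [] []))) (sym (weighted-zero V)))
weighted-cong (suc m) {W} {V} p = trans (weighted-suc m W) (trans
  (geom-cong m (λ k → weighted-cong m (λ ρ ρ≤m → p _ (All-≤-replicate k ρ≤m)))) (sym (weighted-suc m V)))

weighted-stable : ∀ d n W → weighted (d ℕ.+ n) W ≈[ suc n ] weighted n W
weighted-stable zero    n W = ≈⇒≈[] refl
weighted-stable (suc d) n W = ≈[]-trans
  (λ i i≤n → ≈[]-trans (≈⇒≈[] (trans (weighted-suc (d ℕ.+ n) W) (geom-rec (d ℕ.+ n) _)))
    (+q^*-≈[] (suc (d ℕ.+ n)) (weighted (d ℕ.+ n) W) _) i (<-≤-trans i≤n (s≤s (m≤n+m n d))))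
  (weighted-stable d n W)

χ-⇔ : ∀ {P Q : Set} (P? : Dec P) (Q? : Dec Q) → P ⇔ Q → χ P? ≡ χ Q?
χ-⇔ P? Q? e = cong (if_then 1ℤ else 0ℤ) (does-⇔ e P? Q?)

χ-true : ∀ {P : Set} (P? : Dec P) → P → χ P? ≡ 1ℤ
χ-true P? p = cong (if_then 1ℤ else 0ℤ) (dec-true P? p)

χ-false : ∀ {P : Set} (P? : Dec P) → ¬ P → χ P? ≡ 0ℤ
χ-false P? p = cong (if_then 1ℤ else 0ℤ) (dec-false P? p)

-- The weight ω̃₂

-- The restriction to 𝒟 is moved into the weight, so that the recursion over all partitions applies.
distinctWeight : List ℕ → ℤ
distinctWeight π = χ (unique? π) ℤ.* ω̃₂ π

gap : ℕ → List ℕ → ℤ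
gap x π = + 2 ℤ.* + x ℤ.- + 2 ℤ.* + firstPart π ℤ.- 1ℤ

All-≤⇒All-≢ : ∀ {m ρ} → All (ℕ._≤ m) ρ → All (suc m ≡.≢_) ρ
All-≤⇒All-≢ = All.map (λ y≤m eq → <⇒≢ (s≤s y≤m) (≡.sym eq))

distinctWeight-∷ : ∀ {m} ρ → All (ℕ._≤ m) ρ →
                   distinctWeight (suc m ∷ ρ) ≡ gap (suc m) ρ ℤ.* distinctWeight ρ
distinctWeight-∷ {m} ρ ρ≤m = ≡.trans
  (cong (ℤ._* ω̃₂ (suc m ∷ ρ)) (χ-⇔ (unique? (suc m ∷ ρ)) (unique? ρ)
    (mk⇔ AllPairs.tail (All-≤⇒All-≢ ρ≤m ∷_))))
  (exchange (χ (unique? ρ)) (gap (suc m) ρ) (ω̃₂ ρ))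
  where
  exchange : ∀ a b c → a ℤ.* (b ℤ.* c) ≡ b ℤ.* (a ℤ.* c)
  exchange = solve-∀

distinctWeight-∷∷ : ∀ x ρ → distinctWeight (x ∷ x ∷ ρ) ≡ 0ℤ
distinctWeight-∷∷ x ρ = cong (ℤ._* ω̃₂ (x ∷ x ∷ ρ))
  (χ-false (unique? (x ∷ x ∷ ρ)) (λ { ((x≢x ∷ _) ∷ _) → x≢x ≡.refl }))

-- gapSeries m carries the factor that prepending the part m + 1 adds to ω̃₂.
distinctSeries gapSeries : ℕ → Series
distinctSeries m = weighted m distinctWeight
gapSeries      m = weighted m (λ π → gap (suc m) π ℤ.* distinctWeight π)

weighted-𝟎 : ∀ m {W} → (∀ π → All (ℕ._≤ m) π → W π ≡ 0ℤ) → weighted m W ≈ 𝟎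
weighted-𝟎 m {W} p = trans (weighted-cong m {W} {λ π → 0ℤ ℤ.* W π} (λ π π≤m → p π π≤m))
  (trans (weighted-* m 0ℤ W) (solve 1 (λ x → con 0ℤ :* x := con 0ℤ) refl (weighted m W)))

distinctSeries-suc : ∀ m → distinctSeries (suc m) ≈ distinctSeries m + q^ suc m * gapSeries m
distinctSeries-suc m = trans (weighted-suc m distinctWeight) (trans
  (geom-two m _ (λ k → weighted-𝟎 m (λ ρ _ → distinctWeight-∷∷ (suc m) (replicate k (suc m) ++ ρ))))
  (+-congˡ (*-congˡ (weighted-cong m distinctWeight-∷))))

-- Raising the next part from m + 1 to m + 2 widens its gap factor by 2 if m + 1 does not occur. If
-- m + 1 occurs, the gap factor is 2 - 1 = 1.
gapSeries-suc : ∀ m → gapSeries (suc m) ≈ gapSeries m + 𝟐 * distinctSeries m + q^ suc m * gapSeries m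
gapSeries-suc m = trans (weighted-suc m (λ π → gap (suc (suc m)) π ℤ.* distinctWeight π)) (trans
  (geom-two m _ (λ k → weighted-𝟎 m (λ ρ _ → ≡.trans
    (cong (gap (suc (suc m)) (suc m ∷ suc m ∷ replicate k (suc m) ++ ρ) ℤ.*_)
       (distinctWeight-∷∷ (suc m) (replicate k (suc m) ++ ρ)))
    (ℤ.*-zeroʳ (gap (suc (suc m)) (suc m ∷ suc m ∷ replicate k (suc m) ++ ρ))))))
  (+-cong
    (trans (weighted-cong m (λ π _ → widen (+ suc m) (+ firstPart π) (distinctWeight π)))
      (trans (weighted-+ m (λ π → gap (suc m) π ℤ.* distinctWeight π) (λ π → + 2 ℤ.* distinctWeight π))
        (+-congˡ (weighted-* m (+ 2) distinctWeight))))
    (*-congˡ (weighted-cong m (λ ρ ρ≤m → ≡.trans (unit (+ suc m) (distinctWeight (suc m ∷ ρ)))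
      (distinctWeight-∷ ρ ρ≤m))))))
  where
  widen : ∀ x f w → (+ 2 ℤ.* (1ℤ ℤ.+ x) ℤ.- + 2 ℤ.* f ℤ.- 1ℤ) ℤ.* w ≡
                    (+ 2 ℤ.* x ℤ.- + 2 ℤ.* f ℤ.- 1ℤ) ℤ.* w ℤ.+ + 2 ℤ.* w
  widen = solve-∀
  unit : ∀ x w → (+ 2 ℤ.* (1ℤ ℤ.+ x) ℤ.- + 2 ℤ.* x ℤ.- 1ℤ) ℤ.* w ≡ w
  unit = solve-∀

geom-q^suc : ∀ k Y → geom k (λ m → q^ suc m * Y m) ≈ q * geom (suc k) Y
geom-q^suc k Y = trans (geom-cong k (λ m → *-assoc q (q^ m) (Y m)))
  (trans (geom-* k q (λ m → q^ m * Y m)) (*-congˡ (geom-q^ k Y)))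

geom-distinctSeries-suc : ∀ k →
  geom k (distinctSeries ∘ suc) ≈ geom k distinctSeries + q * geom (suc k) gapSeries
geom-distinctSeries-suc k = trans (geom-cong k distinctSeries-suc)
  (trans (geom-+ k distinctSeries _) (+-congˡ (geom-q^suc k gapSeries)))

geom-gapSeries-suc : ∀ k → geom k (gapSeries ∘ suc) ≈
  geom k gapSeries + 𝟐 * geom k distinctSeries + q * geom (suc k) gapSeries
geom-gapSeries-suc k = trans (geom-cong k gapSeries-suc)
  (trans (geom-+ k (λ m → gapSeries m + 𝟐 * distinctSeries m) _)
    (+-cong (trans (geom-+ k gapSeries _) (+-congˡ (geom-* k 𝟐 distinctSeries))) (geom-q^suc k gapSeries)))

-- chain k is the sum of ω̃₂(π) q^(|π| + k λ₁) over the partitions π into distinct parts.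
chain : ℕ → Series
chain k = 𝟏 + q^ suc k * geom k gapSeries

-- Summation by parts: the factor 1 - q^(k+1) replaces `distinctSeries` by its increments q^(m+1)
-- `gapSeries m`, and the extra power q^(m+1) raises k by one.
geom-distinctSeries : ∀ k → (𝟏 - q^ suc k) * geom k distinctSeries ≈ chain (suc k)
geom-distinctSeries k = combine₃ 𝟏 𝟏 (q^ suc k)
  (geom-rec k distinctSeries) (weighted-zero distinctWeight) (geom-distinctSeries-suc k)
  (solve 6 (λ Q K E E′ G e₀ → let Y = Q :* K in
     (:1 :- Y) :* E := :1 :+ Q :* Y :* G :+ :1 :* (E :- (e₀ :+ Y :* E′))
     :+ :1 :* (e₀ :- :1) :+ Y :* (E′ :- (E :+ Q :* G)))
   refl q (q^ k) (geom k distinctSeries) (geom k (distinctSeries ∘ suc)) (geom (suc k) gapSeries)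
     (distinctSeries 0))

geom-gapSeries : ∀ k → (𝟏 - q^ suc k) * geom k gapSeries ≈ chain (suc k) + 𝟐 * q^ suc k * geom k distinctSeries
geom-gapSeries k = combine₃ 𝟏 𝟏 (q^ suc k)
  (geom-rec k gapSeries) (weighted-zero (λ π → gap 1 π ℤ.* distinctWeight π)) (geom-gapSeries-suc k)
  (solve 7 (λ Q K E G G′ G⁺ g₀ → let Y = Q :* K in
     (:1 :- Y) :* G := (:1 :+ Q :* Y :* G⁺) :+ :2 :* Y :* E :+ :1 :* (G :- (g₀ :+ Y :* G′))
     :+ :1 :* (g₀ :- :1) :+ Y :* (G′ :- (G :+ :2 :* E :+ Q :* G⁺)))
   refl q (q^ k) (geom k distinctSeries) (geom k gapSeries) (geom k (gapSeries ∘ suc))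
     (geom (suc k) gapSeries) (gapSeries 0))

-- With y = q^(k+1), eliminating both sums over m gives (1 - y)² `chain k` = (1 - y)² + y (1 + y)
-- `chain (suc k)`, the recurrence `heine-rec k k`. The ratio is Σ (2d - 1) y^d over d ≥ 1, where d
-- is the difference between the largest part and the next.
chain-heine : ∀ k → chain k ≈ heine k k
chain-heine k = x-y≈𝟎⇒x≈y (Contraction.vanish suc
  (λ k → q^ k + q^ k - q * (q^ k * q^ k)) (λ k → q^ k * (𝟏 + q^ suc k))
  (λ k → chain k - heine k k)
  (λ k → combine₃ (q^ suc k * (𝟏 - q^ suc k)) (𝟐 * q^ suc k * q^ suc k) (- 𝟏)
    (geom-gapSeries k) (geom-distinctSeries k) (heine-rec k k)
    (solve 7 (λ Q K E G V U U′ → let Y = Q :* K in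
       (:1 :+ Y :* G) :- U :=
       Q :* ((K :+ K :- Q :* (K :* K)) :* ((:1 :+ Y :* G) :- U) :+ K :* (:1 :+ Y) :* (V :- U′))
       :+ Y :* (:1 :- Y) :* ((:1 :- Y) :* G :- (V :+ :2 :* Y :* E))
       :+ :2 :* Y :* Y :* ((:1 :- Y) :* E :- V)
       :+ (:- :1) :* ((:1 :- Y) :* (:1 :- Y) :* U :- ((:1 :- Y) :* (:1 :- Y) :+ Y :* (:1 :+ Y) :* U′)))
     refl q (q^ k) (geom k distinctSeries) (geom k gapSeries) (chain (suc k)) (heine k k)
       (heine (suc k) (suc k)))) k)

-- Remainder form of the limit m → ∞: the last term collects the partitions with largest part above
-- m.
chain-0-tailProduct : ∀ m → chain 0 ≈ distinctSeries m + q^ suc m * geom 0 (λ k → gapSeries (k ℕ.+ m))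
chain-0-tailProduct zero    = +-cong (sym (weighted-zero distinctWeight))
  (*-congˡ (geom-cong 0 (λ k → reflexive (cong gapSeries (≡.sym (+-identityʳ k))))))
chain-0-tailProduct (suc m) = combine₄ 𝟏 (q^ suc m) (q^ suc (suc m)) (- 𝟏)
  (chain-0-tailProduct m) (geom-rec 0 (λ k → gapSeries (k ℕ.+ m)))
  (geom-cong 0 {λ k → gapSeries (suc k ℕ.+ m)} (λ k → reflexive (cong gapSeries (≡.sym (+-suc k m)))))
  (distinctSeries-suc m)
  (solve 9 (λ Q M V e e′ g G G′ G″ → let X = Q :* M in
     V := e′ :+ Q :* X :* G″ :+ :1 :* (V :- (e :+ X :* G)) :+ X :* (G :- (g :+ Q :* :1 :* G′))
     :+ Q :* X :* (G′ :- G″) :+ (:- :1) :* (e′ :- (e :+ X :* g)))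
   refl q (q^ m) (chain 0) (distinctSeries m) (distinctSeries (suc m)) (gapSeries m)
     (geom 0 (λ k → gapSeries (k ℕ.+ m))) (geom 0 (λ k → gapSeries (suc k ℕ.+ m)))
     (geom 0 (λ k → gapSeries (k ℕ.+ suc m))))

common : Series
common = tailProduct 0 * fine 0 0

∑q-ω̃₂ : ∑q 𝒟 ω̃₂ ≗ coeff common
∑q-ω̃₂ n = begin
  ∑ (filter unique? (𝒰 n)) ω̃₂                             ≡⟨ ∑-filter unique? (𝒰 n) ω̃₂ ⟩
  ∑ (𝒰 n) (λ π → if does (unique? π) then ω̃₂ π else 0ℤ) ≡⟨ ∑-cong (𝒰 n) indicator ⟩
  ∑ (𝒰 n) distinctWeight                                   ≡⟨ coeff-series _ n ⟨
  coeff (distinctSeries n) n                               ≡⟨ +q^*-≈[] (suc n) _ _ n ≤-refl ⟨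
  coeff (distinctSeries n + q^ suc n * geom 0 (λ k → gapSeries (k ℕ.+ n))) n
                                                           ≡⟨ coeff-cong (chain-0-tailProduct n) n ⟨
  coeff (chain 0) n                                        ≡⟨ coeff-cong (trans (chain-heine 0) (heine-fine 0)) n ⟩
  coeff common n ∎
  where
  open ≡.≡-Reasoning
  indicator : ∀ π → (if does (unique? π) then ω̃₂ π else 0ℤ) ≡ distinctWeight π
  indicator π with does (unique? π)
  ... | true  = ≡.sym (ℤ.*-identityˡ (ω̃₂ π))
  ... | false = ≡.refl

∑-congᵃ : ∀ {A : Set} {xs : List A} {f g : A → ℤ} → All (λ x → f x ≡ g x) xs → ∑ xs f ≡ ∑ xs g
∑-congᵃ []       = ≡.refl
∑-congᵃ (p ∷ ps) = cong₂ ℤ._+_ p (∑-congᵃ ps)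

∑-𝒰-cong : ∀ n W V → (∀ π → size π ≡ n → W π ≡ V π) → ∑ (𝒰 n) W ≡ ∑ (𝒰 n) V
∑-𝒰-cong n W V p = ∑-congᵃ (All.tabulate (λ {π} π∈ → p π (proj₂ (Equivalence.to (∈-𝒰 n π) π∈))))

∑-upTo-suc : ∀ N (f : ℕ → ℤ) → ∑ (upTo (suc N)) f ≡ f 0 ℤ.+ ∑ (upTo N) (f ∘ suc)
∑-upTo-suc N f = cong (ℤ._+_ (f 0)) (≡.trans
  (cong (λ ks → ∑ ks f) (≡.sym (map-upTo suc N))) (∑-map suc (upTo N) f))

∑-χ≟ : ∀ N i → i ℕ.< N → ∑ (upTo N) (λ j → χ (j ≟ i)) ≡ 1ℤ
∑-χ≟ (suc N) zero    _         = ≡.trans (∑-upTo-suc N (λ j → χ (j ≟ 0)))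
  (cong (ℤ._+_ 1ℤ) (∑-zero (upTo N)))
∑-χ≟ (suc N) (suc i) (s≤s i<N) = ≡.trans (∑-upTo-suc N (λ j → χ (j ≟ suc i)))
  (≡.trans (ℤ.+-identityˡ _) (≡.trans
    (∑-cong (upTo N) (λ j → χ-⇔ (suc j ≟ suc i) (j ≟ i) (mk⇔ suc-injective (cong suc)))) (∑-χ≟ N i i<N)))

-- The weight ω₂′

deduplicate-replicate : ∀ k {x : ℕ} {ρ} → All (x ≢_) ρ →
  deduplicate _≟_ (replicate (suc k) x ++ ρ) ≡ x ∷ deduplicate _≟_ ρ
deduplicate-replicate zero    {x} {ρ} x∉ρ =
  cong (x ∷_) (filter-all (¬? ∘ (x ≟_)) (All.deduplicate⁺ _≟_ x∉ρ))
deduplicate-replicate (suc k) {x} {ρ} x∉ρ = cong (x ∷_) (≡.trans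
  (cong (filter (¬? ∘ (x ≟_))) (deduplicate-replicate k x∉ρ))
  (≡.trans (filter-reject (¬? ∘ (x ≟_)) (λ x≢x → x≢x ≡.refl))
           (filter-all (¬? ∘ (x ≟_)) (All.deduplicate⁺ _≟_ x∉ρ))))

∈-replicate-++ : ∀ k {x y : ℕ} {ρ} → y ≢ x → y ∈ replicate k x ++ ρ → y ∈ ρ
∈-replicate-++ zero    y≢x y∈         = y∈
∈-replicate-++ (suc k) y≢x (here y≡x) = contradiction y≡x y≢x
∈-replicate-++ (suc k) y≢x (there y∈) = ∈-replicate-++ k y≢x y∈

evenFactor oddFactor : ℕ → ℤ
evenFactor x = if does (2 ∣? x) then + 2 else 1ℤ
oddFactor  x = if does (2 ∣? x) then 1ℤ else + 2

evenFactor*oddFactor : ∀ x → evenFactor x ℤ.* oddFactor x ≡ + 2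
evenFactor*oddFactor x with does (2 ∣? x)
... | true  = ≡.refl
... | false = ≡.refl

2^-suc : ∀ k → 2^ (suc k) ≡ + 2 ℤ.* 2^ k
2^-suc k = ℤ.pos-* 2 (2 ℕ.^ k)

evenWeight : List ℕ → ℤ
evenWeight π = 2^ (ν-de π)

evenWeight-replicate : ∀ k {x ρ} → All (x ≢_) ρ →
  evenWeight (replicate (suc k) x ++ ρ) ≡ evenFactor x ℤ.* evenWeight ρ
evenWeight-replicate k {x} {ρ} x∉ρ =
  ≡.trans (cong (2^_ ∘ length ∘ filter (2 ∣?_)) (deduplicate-replicate k x∉ρ)) (prepend (deduplicate _≟_ ρ))
  where
  prepend : ∀ ds → 2^ (length (filter (2 ∣?_) (x ∷ ds))) ≡ evenFactor x ℤ.* 2^ (length (filter (2 ∣?_) ds))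
  prepend ds with does (2 ∣? x)
  ... | true  = 2^-suc (length (filter (2 ∣?_) ds))
  ... | false = ≡.sym (ℤ.*-identityˡ (2^ (length (filter (2 ∣?_) ds))))

oddTerm : List ℕ → ℕ → ℤ
oddTerm π i = χ ((4 ℕ.* i ℕ.+ 3) ∈? π) ℤ.* 2^ (μ-o (4 ℕ.* i ℕ.+ 3) π)

4i+3-odd : ∀ i → ¬ 2 ∣ 4 ℕ.* i ℕ.+ 3
4i+3-odd i 2∣ with ∣1⇒≡1 (∣m+n∣m⇒∣n {n = 1} (∣m+n∣m⇒∣n {n = 3} 2∣
  (≡.subst (2 ∣_) (ℕ.*-comm i 4) (∣-trans (divides 2 ≡.refl) (n∣m*n i)))) (divides 1 ≡.refl))
... | ()

oddTerm-∉ : ∀ π i → 4 ℕ.* i ℕ.+ 3 ∉ π → oddTerm π i ≡ 0ℤ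
oddTerm-∉ π i ∉π = cong (ℤ._* 2^ (μ-o (4 ℕ.* i ℕ.+ 3) π)) (χ-false (_ ∈? π) ∉π)

All-≤⇒∉ : ∀ {m y ρ} → All (ℕ._≤ m) ρ → m ℕ.< y → y ∉ ρ
All-≤⇒∉ ρ≤m m<y y∈ρ = <⇒≱ m<y (All.lookup ρ≤m y∈ρ)

-- A new largest part counts once whatever its multiplicity. If it is odd, it doubles every term
-- already present; if it equals 4i + 3, it creates a term of value 2, since no other part is as
-- large.
oddTerm-replicate : ∀ k {m ρ} i → All (ℕ._≤ m) ρ → oddTerm (replicate (suc k) (suc m) ++ ρ) i ≡
  oddFactor (suc m) ℤ.* oddTerm ρ i ℤ.+ + 2 ℤ.* χ (4 ℕ.* i ℕ.+ 3 ≟ suc m)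
oddTerm-replicate k {m} {ρ} i ρ≤m = go (y ≟ suc m)
  where
  y : ℕ
  y = 4 ℕ.* i ℕ.+ 3
  π : List ℕ
  π = replicate (suc k) (suc m) ++ ρ
  odd≥y? : Decidable (λ z → ¬ 2 ∣ z × y ℕ.≤ z)
  odd≥y? z = ¬? (2 ∣? z) ×-dec (y ≤? z)
  dedup : deduplicate _≟_ π ≡ suc m ∷ deduplicate _≟_ ρ
  dedup = deduplicate-replicate k (All-≤⇒All-≢ ρ≤m)
  go : Dec (y ≡ suc m) → oddTerm π i ≡ oddFactor (suc m) ℤ.* oddTerm ρ i ℤ.+ + 2 ℤ.* χ (y ≟ suc m)
  go (yes y≡) = ≡.trans (cong₂ ℤ._*_ (χ-true (y ∈? π) (here y≡)) (cong 2^_ μ≡1))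
    (≡.sym (cong₂ ℤ._+_
      (≡.trans (cong (ℤ._*_ (oddFactor (suc m))) (oddTerm-∉ ρ i (All-≤⇒∉ ρ≤m (ℕ.≤-reflexive (≡.sym y≡)))))
               (ℤ.*-zeroʳ (oddFactor (suc m))))
      (cong (ℤ._*_ (+ 2)) (χ-true (y ≟ suc m) y≡))))
    where
    μ≡1 : μ-o y π ≡ 1
    μ≡1 = cong length (≡.trans (cong (filter odd≥y?) dedup)
      (≡.trans (filter-accept odd≥y? (≡.subst (λ z → ¬ 2 ∣ z) y≡ (4i+3-odd i) , ℕ.≤-reflexive y≡))
        (cong (suc m ∷_) (filter-none odd≥y? (All.deduplicate⁺ _≟_
          (All.map (λ z≤m (_ , y≤z) → <⇒≱ (s≤s z≤m) (≤-trans (ℕ.≤-reflexive (≡.sym y≡)) y≤z)) ρ≤m))))))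
  go (no y≢) = ≡.trans (rest (y ∈? ρ)) (≡.sym (≡.trans
    (cong (λ c → oddFactor (suc m) ℤ.* oddTerm ρ i ℤ.+ + 2 ℤ.* c) (χ-false (y ≟ suc m) y≢)) (ℤ.+-identityʳ _)))
    where
    rest : Dec (y ∈ ρ) → oddTerm π i ≡ oddFactor (suc m) ℤ.* oddTerm ρ i
    rest (no y∉) = ≡.trans (oddTerm-∉ π i (y∉ ∘ ∈-replicate-++ (suc k) y≢)) (≡.sym
      (≡.trans (cong (ℤ._*_ (oddFactor (suc m))) (oddTerm-∉ ρ i y∉)) (ℤ.*-zeroʳ (oddFactor (suc m)))))
    rest (yes y∈) = ≡.trans
      (cong₂ ℤ._*_
        (≡.trans (χ-true (y ∈? π) (∈-++⁺ʳ (replicate (suc k) (suc m)) y∈)) (≡.sym (χ-true (y ∈? ρ) y∈)))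
        (μ-step (2 ∣? suc m)))
      (exchange (χ (y ∈? ρ)) (oddFactor (suc m)) (2^ (μ-o y ρ)))
      where
      exchange : ∀ a b c → a ℤ.* (b ℤ.* c) ≡ b ℤ.* (a ℤ.* c)
      exchange = solve-∀
      y≤ : y ℕ.≤ suc m
      y≤ = m≤n⇒m≤1+n (All.lookup ρ≤m y∈)
      μ-step : Dec (2 ∣ suc m) → 2^ (μ-o y π) ≡ oddFactor (suc m) ℤ.* 2^ (μ-o y ρ)
      μ-step (yes 2∣) = ≡.trans
        (cong (2^_ ∘ length) (≡.trans (cong (filter odd≥y?) dedup) (filter-reject odd≥y? (λ (2∤ , _) → 2∤ 2∣))))
        (≡.sym (≡.trans (cong (λ b → (if b then 1ℤ else + 2) ℤ.* 2^ (μ-o y ρ)) (dec-true (2 ∣? suc m) 2∣))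
          (ℤ.*-identityˡ _)))
      μ-step (no 2∤) = ≡.trans
        (cong (2^_ ∘ length) (≡.trans (cong (filter odd≥y?) dedup) (filter-accept odd≥y? (2∤ , y≤))))
        (≡.trans (2^-suc (μ-o y ρ))
          (≡.sym (cong (λ b → (if b then 1ℤ else + 2) ℤ.* 2^ (μ-o y ρ)) (dec-false (2 ∣? suc m) 2∤))))

geom-eventually : ∀ i Y {y} → (∀ k → Y (suc k) ≈ y) →
  (𝟏 - q^ suc i) * geom i Y ≈ (𝟏 - q^ suc i) * Y 0 + q^ suc i * y
geom-eventually i Y {y} p = combine₂ (𝟏 - q^ suc i) (q^ suc i) (geom-rec i Y)
  (trans (*-congˡ (geom-cong i p)) (geom-constant i y))
  (solve 5 (λ X G G′ Y₀ y → (:1 :- X) :* G := (:1 :- X) :* Y₀ :+ X :* y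
     :+ (:1 :- X) :* (G :- (Y₀ :+ X :* G′)) :+ X :* ((:1 :- X) :* G′ :- y))
   refl (q^ suc i) (geom i Y) (geom i (Y ∘ suc)) (Y 0) y)

-- A cutoff common to all partitions, rather than one growing with |π|, keeps the sum compatible
-- with prepending parts.
module Bounded (M : ℕ) where

  oddSum : List ℕ → ℤ
  oddSum π = ∑ (upTo (suc M)) (oddTerm π)

  δ : ℕ → ℤ
  δ x = ∑ (upTo (suc M)) (λ i → χ (4 ℕ.* i ℕ.+ 3 ≟ x))

  oddWeight : List ℕ → ℤ
  oddWeight π = evenWeight π ℤ.* oddSum π

  oddSum-replicate : ∀ k {m ρ} → All (ℕ._≤ m) ρ → oddSum (replicate (suc k) (suc m) ++ ρ) ≡
    oddFactor (suc m) ℤ.* oddSum ρ ℤ.+ + 2 ℤ.* δ (suc m)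
  oddSum-replicate k {m} {ρ} ρ≤m = ≡.trans
    (∑-cong (upTo (suc M)) (λ i → oddTerm-replicate k i ρ≤m))
    (≡.trans (∑-+ (upTo (suc M)) (λ i → oddFactor (suc m) ℤ.* oddTerm ρ i)
        (λ i → + 2 ℤ.* χ (4 ℕ.* i ℕ.+ 3 ≟ suc m)))
      (cong₂ ℤ._+_ (∑-*ˡ (upTo (suc M)) (oddFactor (suc m)) (oddTerm ρ))
                   (∑-*ˡ (upTo (suc M)) (+ 2) (λ i → χ (4 ℕ.* i ℕ.+ 3 ≟ suc m)))))

  -- Even and odd factors multiply to 2, so the old terms double whatever the parity of m + 1. This
  -- produces (1 + x)/(1 - x) with x = q^(m+1), the very factor that `tailProduct` loses.
  oddWeight-replicate : ∀ k {m ρ} → All (ℕ._≤ m) ρ → oddWeight (replicate (suc k) (suc m) ++ ρ) ≡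
    + 2 ℤ.* oddWeight ρ ℤ.+ evenFactor (suc m) ℤ.* (+ 2 ℤ.* δ (suc m)) ℤ.* evenWeight ρ
  oddWeight-replicate k {m} {ρ} ρ≤m = ≡.trans
    (cong₂ ℤ._*_ (evenWeight-replicate k (All-≤⇒All-≢ ρ≤m)) (oddSum-replicate k ρ≤m))
    (≡.trans (regroup (evenFactor (suc m)) (evenWeight ρ) (oddFactor (suc m)) (oddSum ρ) (+ 2 ℤ.* δ (suc m)))
      (cong (λ c → c ℤ.* oddWeight ρ ℤ.+ evenFactor (suc m) ℤ.* (+ 2 ℤ.* δ (suc m)) ℤ.* evenWeight ρ)
        (evenFactor*oddFactor (suc m))))
    where
    regroup : ∀ e w o s d → e ℤ.* w ℤ.* (o ℤ.* s ℤ.+ d) ≡ e ℤ.* o ℤ.* (w ℤ.* s) ℤ.+ e ℤ.* d ℤ.* w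
    regroup = solve-∀

  evenSeries oddSeries : ℕ → Series
  evenSeries m = weighted m evenWeight
  oddSeries  m = weighted m oddWeight

  stay entry : ℕ → Series
  stay  x = const (evenFactor x)
  entry x = const (evenFactor x ℤ.* (+ 2 ℤ.* δ x))

  evenSeries-suc : ∀ m → (𝟏 - q^ suc m) * evenSeries (suc m) ≈
    (𝟏 - q^ suc m) * evenSeries m + q^ suc m * (stay (suc m) * evenSeries m)
  evenSeries-suc m = trans (*-congˡ (weighted-suc m evenWeight))
    (geom-eventually m _ (λ k → trans
      (weighted-cong m (λ ρ ρ≤m → evenWeight-replicate k (All-≤⇒All-≢ ρ≤m)))
      (weighted-* m (evenFactor (suc m)) evenWeight)))

  oddSeries-suc : ∀ m → (𝟏 - q^ suc m) * oddSeries (suc m) ≈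
    (𝟏 - q^ suc m) * oddSeries m + q^ suc m * (𝟐 * oddSeries m + entry (suc m) * evenSeries m)
  oddSeries-suc m = trans (*-congˡ (weighted-suc m oddWeight))
    (geom-eventually m _ (λ k → trans
      (weighted-cong m (λ ρ ρ≤m → oddWeight-replicate k ρ≤m))
      (trans (weighted-+ m (λ ρ → + 2 ℤ.* oddWeight ρ)
          (λ ρ → evenFactor (suc m) ℤ.* (+ 2 ℤ.* δ (suc m)) ℤ.* evenWeight ρ))
        (+-cong (weighted-* m (+ 2) oddWeight)
          (weighted-* m (evenFactor (suc m) ℤ.* (+ 2 ℤ.* δ (suc m))) evenWeight)))))

  -- Parts above m multiply oddSeries by tailProduct m, and evenSeries by tailProduct m * z.
  Transfer : Series → ℕ → Set
  Transfer z m = common ≈ tailProduct m * (z * evenSeries m + oddSeries m)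

  -- The system for the two series is triangular, and the diagonal entry of `oddSeries` is absorbed
  -- by `tailProduct`. Hence the coefficient of `oddSeries` remains 1 and only z has to be tracked.
  transfer-suc : ∀ {z z′} m →
    (𝟏 + q^ suc m) * z ≈ (𝟏 - q^ suc m + q^ suc m * stay (suc m)) * z′ + q^ suc m * entry (suc m) →
    Transfer z m → Transfer z′ (suc m)
  transfer-suc {z} {z′} m step t = 𝟏-q-cancel (q^ m) (combine₂ (𝟏 - X) 𝟏 t scaled
    (solve 4 (λ X C A B → (:1 :- X) :* C := (:1 :- X) :* B :+ (:1 :- X) :* (C :- A)
        :+ :1 :* ((:1 :- X) :* A :- (:1 :- X) :* B))
      refl X common (tailProduct m * (z * evenSeries m + oddSeries m))
        (tailProduct (suc m) * (z′ * evenSeries (suc m) + oddSeries (suc m)))))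
    where
    X : Series
    X = q^ suc m
    scaled : (𝟏 - X) * (tailProduct m * (z * evenSeries m + oddSeries m)) ≈
             (𝟏 - X) * (tailProduct (suc m) * (z′ * evenSeries (suc m) + oddSeries (suc m)))
    scaled = combine₄ (z * evenSeries m + oddSeries m) (- (tailProduct (suc m) * z′)) (- tailProduct (suc m))
      (tailProduct (suc m) * evenSeries m) (tailProduct-rec m) (evenSeries-suc m) (oddSeries-suc m) step
      (solve 11 (λ X P P′ z z′ E O E′ O′ s e →
        (:1 :- X) :* (P :* (z :* E :+ O)) := (:1 :- X) :* (P′ :* (z′ :* E′ :+ O′))
        :+ (z :* E :+ O) :* ((:1 :- X) :* P :- (:1 :+ X) :* P′)
        :+ (:- (P′ :* z′)) :* ((:1 :- X) :* E′ :- ((:1 :- X) :* E :+ X :* (s :* E)))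
        :+ (:- P′) :* ((:1 :- X) :* O′ :- ((:1 :- X) :* O :+ X :* (:2 :* O :+ e :* E)))
        :+ P′ :* E :* ((:1 :+ X) :* z :- ((:1 :- X :+ X :* s) :* z′ :+ X :* e)))
       refl X (tailProduct m) (tailProduct (suc m)) z z′ (evenSeries m) (oddSeries m)
         (evenSeries (suc m)) (oddSeries (suc m)) (stay (suc m)) (entry (suc m)))

  residue-mod-4 : ∀ {r s} i j → 4 ℕ.* j ℕ.+ s ≡ r ℕ.+ i ℕ.* 4 → s % 4 ≡ r % 4
  residue-mod-4 {r} {s} i j eq = ≡.trans (≡.sym ([m+kn]%n≡m%n s j 4)) (≡.trans
    (cong (_% 4) (≡.trans (ℕ.+-comm s (j ℕ.* 4)) (≡.trans (cong (ℕ._+ s) (ℕ.*-comm j 4)) eq))) ([m+kn]%n≡m%n r i 4))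

  δ-zero : ∀ r i → 3 ≢ r % 4 → δ (r ℕ.+ i ℕ.* 4) ≡ 0ℤ
  δ-zero r i 3≢ = ≡.trans (∑-cong (upTo (suc M)) (λ j → χ-false (4 ℕ.* j ℕ.+ 3 ≟ r ℕ.+ i ℕ.* 4) (3≢ ∘ residue-mod-4 {r} i j)))
    (∑-zero (upTo (suc M)))

  δ-one : ∀ i → i ℕ.≤ M → δ (3 ℕ.+ i ℕ.* 4) ≡ 1ℤ
  δ-one i i≤M = ≡.trans (∑-cong (upTo (suc M)) (λ j → χ-⇔ (4 ℕ.* j ℕ.+ 3 ≟ 3 ℕ.+ i ℕ.* 4) (j ≟ i) (mk⇔
      (λ eq → ℕ.*-cancelʳ-≡ j i 4 (ℕ.+-cancelˡ-≡ 3 _ _ (≡.trans (≡.sym (shape j)) eq)))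
      (λ { ≡.refl → shape j }))))
    (∑-χ≟ (suc M) i (s≤s i≤M))
    where
    shape : ∀ j → 4 ℕ.* j ℕ.+ 3 ≡ 3 ℕ.+ j ℕ.* 4
    shape j = ≡.trans (ℕ.+-comm (4 ℕ.* j) 3) (cong (3 ℕ.+_) (ℕ.*-comm 4 j))

  evenFactor-mod : ∀ r i → evenFactor (r ℕ.+ i ℕ.* 4) ≡ evenFactor r
  evenFactor-mod r i = cong (if_then + 2 else 1ℤ) (does-⇔
    (mk⇔ (λ p → ∣m+n∣m⇒∣n (≡.subst (2 ∣_) (ℕ.+-comm r (i ℕ.* 4)) p) 2∣i4) (λ p → ∣m∣n⇒∣m+n p 2∣i4))
    (2 ∣? (r ℕ.+ i ℕ.* 4)) (2 ∣? r))
    where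
    2∣i4 : 2 ∣ i ℕ.* 4
    2∣i4 = ∣-trans (divides 2 ≡.refl) (n∣m*n i)

  stay-≈ : ∀ r i → stay (r ℕ.+ i ℕ.* 4) ≈ const (evenFactor r)
  stay-≈ r i = reflexive (cong const (evenFactor-mod r i))

  entry-≈ : ∀ r i {d} → δ (r ℕ.+ i ℕ.* 4) ≡ d → entry (r ℕ.+ i ℕ.* 4) ≈ const (evenFactor r ℤ.* (+ 2 ℤ.* d))
  entry-≈ r i p = reflexive (cong₂ (λ f d → const (f ℤ.* (+ 2 ℤ.* d))) (evenFactor-mod r i) p)

  even-step : ∀ r i z → evenFactor r ≡ + 2 → 3 ≢ r % 4 → let X = q^ (r ℕ.+ i ℕ.* 4) in
    (𝟏 + X) * z ≈ (𝟏 - X + X * stay (r ℕ.+ i ℕ.* 4)) * z + X * entry (r ℕ.+ i ℕ.* 4)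
  even-step r i z ef 3≢ = combine₂ (- (X * z)) (- X)
    (trans (stay-≈ r i) (reflexive (cong const ef)))
    (trans (entry-≈ r i (δ-zero r i 3≢)) (reflexive (cong (λ f → const (f ℤ.* 0ℤ)) ef)))
    (solve 4 (λ X z s e → (:1 :+ X) :* z := ((:1 :- X :+ X :* s) :* z :+ X :* e)
       :+ (:- (X :* z)) :* (s :- :2) :+ (:- X) :* (e :- con 0ℤ))
     refl X z (stay (r ℕ.+ i ℕ.* 4)) (entry (r ℕ.+ i ℕ.* 4)))
    where
    X : Series
    X = q^ (r ℕ.+ i ℕ.* 4)

  -- Even parts leave z unchanged. The part 4i + 1 turns `oddTail` at 4i into 2 - `oddTail` at 4i +
  -- 2. At the part 4i + 3, with x = q^(4i+3), (1 + x) times that value is 2x + `oddTail` at 4i + 4,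
  -- and the 2x is exactly the entry of a new term.
  transfer-block : ∀ i → i ℕ.≤ M → Transfer (oddTail (i ℕ.* 4)) (i ℕ.* 4) →
                   Transfer (oddTail (suc i ℕ.* 4)) (suc i ℕ.* 4)
  transfer-block i i≤M t =
    transfer-suc (3 ℕ.+ i ℕ.* 4) (even-step 4 i _ ≡.refl (λ ()))
    (transfer-suc (2 ℕ.+ i ℕ.* 4) thirdStep
    (transfer-suc (1 ℕ.+ i ℕ.* 4) (even-step 2 i _ ≡.refl (λ ()))
    (transfer-suc (i ℕ.* 4) firstStep t)))
    where
    firstStep : (𝟏 + q^ (1 ℕ.+ i ℕ.* 4)) * oddTail (i ℕ.* 4) ≈
      (𝟏 - q^ (1 ℕ.+ i ℕ.* 4) + q^ (1 ℕ.+ i ℕ.* 4) * stay (1 ℕ.+ i ℕ.* 4)) * (𝟐 - oddTail (2 ℕ.+ i ℕ.* 4))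
      + q^ (1 ℕ.+ i ℕ.* 4) * entry (1 ℕ.+ i ℕ.* 4)
    firstStep = combine₃ 𝟏 (- (q^ (1 ℕ.+ i ℕ.* 4) * (𝟐 - oddTail (2 ℕ.+ i ℕ.* 4)))) (- q^ (1 ℕ.+ i ℕ.* 4))
      (oddTail-rec (i ℕ.* 4)) (stay-≈ 1 i) (entry-≈ 1 i (δ-zero 1 i (λ ())))
      (solve 5 (λ X z z′ s e → (:1 :+ X) :* z := ((:1 :- X :+ X :* s) :* (:2 :- z′) :+ X :* e)
         :+ :1 :* ((:1 :+ X) :* z :- (:2 :- z′))
         :+ (:- (X :* (:2 :- z′))) :* (s :- :1) :+ (:- X) :* (e :- con 0ℤ))
       refl (q^ (1 ℕ.+ i ℕ.* 4)) (oddTail (i ℕ.* 4)) (oddTail (2 ℕ.+ i ℕ.* 4))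
         (stay (1 ℕ.+ i ℕ.* 4)) (entry (1 ℕ.+ i ℕ.* 4)))
    thirdStep : (𝟏 + q^ (3 ℕ.+ i ℕ.* 4)) * (𝟐 - oddTail (2 ℕ.+ i ℕ.* 4)) ≈
      (𝟏 - q^ (3 ℕ.+ i ℕ.* 4) + q^ (3 ℕ.+ i ℕ.* 4) * stay (3 ℕ.+ i ℕ.* 4)) * oddTail (4 ℕ.+ i ℕ.* 4)
      + q^ (3 ℕ.+ i ℕ.* 4) * entry (3 ℕ.+ i ℕ.* 4)
    thirdStep = combine₃ (- 𝟏) (- (q^ (3 ℕ.+ i ℕ.* 4) * oddTail (4 ℕ.+ i ℕ.* 4))) (- q^ (3 ℕ.+ i ℕ.* 4))
      (oddTail-rec (2 ℕ.+ i ℕ.* 4)) (stay-≈ 3 i) (entry-≈ 3 i (δ-one i i≤M))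
      (solve 5 (λ X z z′ s e → (:1 :+ X) :* (:2 :- z) := ((:1 :- X :+ X :* s) :* z′ :+ X :* e)
         :+ (:- :1) :* ((:1 :+ X) :* z :- (:2 :- z′))
         :+ (:- (X :* z′)) :* (s :- :1) :+ (:- X) :* (e :- :2))
       refl (q^ (3 ℕ.+ i ℕ.* 4)) (oddTail (2 ℕ.+ i ℕ.* 4)) (oddTail (4 ℕ.+ i ℕ.* 4))
         (stay (3 ℕ.+ i ℕ.* 4)) (entry (3 ℕ.+ i ℕ.* 4)))

  transfer : ∀ i → i ℕ.≤ suc M → Transfer (oddTail (i ℕ.* 4)) (i ℕ.* 4)
  transfer zero    _         = combine₃ (tailProduct 0) (- (tailProduct 0 * oddTail 0)) (- tailProduct 0)
    fine-oddTail (weighted-zero evenWeight)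
    (trans (weighted-zero oddWeight)
      (reflexive (cong const (≡.trans (ℤ.*-identityˡ (oddSum [])) (∑-zero (upTo (suc M)))))))
    (solve 5 (λ P F z E O → P :* F := P :* (z :* E :+ O) :+ P :* (F :- z)
        :+ (:- (P :* z)) :* (E :- :1) :+ (:- P) :* (O :- con 0ℤ))
      refl (tailProduct 0) (fine 0 0) (oddTail 0) (evenSeries 0) (oddSeries 0))
  transfer (suc i) (s≤s i≤M) = transfer-block i i≤M (transfer i (m≤n⇒m≤1+n i≤M))

-- Read off from `gauss-rec 0 m`, with the geometric series `I₀` and `I` as inverses of 1 - q and 1
-- - q^(m+1); the 2 is 1 + q^0.
tailProduct-congruent-𝟏 : ∀ m → Σ[ y ∈ Series ] tailProduct m ≈ 𝟏 + q^ suc m * y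
tailProduct-congruent-𝟏 m = I₀ * I * 𝟐 * gauss 1 (suc m) ,
  combine₃ (I₀ * I) (- (tailProduct m - 𝟏)) (- ((tailProduct m - 𝟏) * ((𝟏 - q * 𝟏) * I₀)))
    (gauss-rec 0 m) (geom-constant 0 𝟏) (geom-constant m 𝟏)
    (solve 6 (λ Q X I₀ I N N′ → let Q₁ = Q :* :1 in
       N := :1 :+ X :* (I₀ :* I :* :2 :* N′)
       :+ I₀ :* I :* ((:1 :- Q₁) :* (:1 :- X) :* N :- ((:1 :- Q₁) :* (:1 :- X) :+ X :* (:1 :+ :1) :* N′))
       :+ (:- (N :- :1)) :* ((:1 :- Q₁) :* I₀ :- :1)
       :+ (:- ((N :- :1) :* ((:1 :- Q₁) :* I₀))) :* ((:1 :- X) :* I :- :1))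
     refl q (q^ suc m) I₀ I (tailProduct m) (gauss 1 (suc m)))
  where
  I₀ I : Series
  I₀ = geom 0 (λ _ → 𝟏)
  I  = geom m (λ _ → 𝟏)

∑q-ω₂′ : ∑q 𝒰 ω₂′ ≗ coeff common
∑q-ω₂′ n = begin
  ∑ (𝒰 n) ω₂′                                        ≡⟨ ∑-𝒰-cong n ω₂′ W split ⟩
  ∑ (𝒰 n) W                                         ≡⟨ coeff-series _ n ⟨
  coeff (weighted n W) n                            ≡⟨ weighted-stable (m ℕ.∸ n) n W n ≤-refl ⟨
  coeff (weighted (m ℕ.∸ n ℕ.+ n) W) n              ≡⟨ cong (λ k → coeff (weighted k W) n) (m∸n+n≡m n≤m) ⟩
  coeff (weighted m W) n                            ≡⟨ +q^*-≈[] (suc m) (weighted m W) remainder n (s≤s n≤m) ⟨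
  coeff (weighted m W + q^ suc m * remainder) n     ≡⟨ coeff-cong expand n ⟨
  coeff common n                                    ∎
  where
  open ≡.≡-Reasoning
  open Bounded n
  m : ℕ
  -- `transfer` is stated at multiples of 4, and any bound ≥ n on the parts yields the same
  -- coefficient n.
  m = n ℕ.* 4
  n≤m : n ℕ.≤ m
  n≤m = m≤m*n n 4
  W : List ℕ → ℤ
  W π = evenWeight π ℤ.+ oddWeight π
  split : ∀ π → size π ≡ n → ω₂′ π ≡ W π
  split π ≡.refl = ≡.trans (ℤ.*-distribˡ-+ (evenWeight π) 1ℤ (oddSum π))
    (cong (λ w → w ℤ.+ oddWeight π) (ℤ.*-identityʳ (evenWeight π)))
  y z E O remainder : Series
  y = proj₁ (tailProduct-congruent-𝟏 m)
  z = symFine m 1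
  E = evenSeries m
  O = oddSeries m
  remainder = y * (oddTail m * E + O) - z * E
  expand : common ≈ weighted m W + q^ suc m * remainder
  expand = combine₃ 𝟏 ((𝟏 - q^ suc m * z) * E + O) (- 𝟏)
    (transfer n (n≤1+n n)) (proj₂ (tailProduct-congruent-𝟏 m)) (weighted-+ m evenWeight oddWeight)
    (solve 8 (λ C X P y z E O W → let c = :1 :- X :* z in
       C := W :+ X :* (y :* (c :* E :+ O) :- z :* E) :+ :1 :* (C :- P :* (c :* E :+ O))
       :+ (c :* E :+ O) :* (P :- (:1 :+ X :* y)) :+ (:- :1) :* (W :- (E :+ O)))
     refl common (q^ suc m) (tailProduct m) y z E O (weighted m W))

-- The weight ω₂*

data Kind : Set where
  free atMostOnce twice thrice : Kind

kindWeight : Kind → ℕ → ℤ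
kindWeight free       k = 2^χ (1 ≤? k)
kindWeight atMostOnce k = χ (k ≤? 1)
kindWeight twice      k = χ (2 ≤? k) ℤ.* 2^χ (3 ≤? k)
kindWeight thrice     k = χ (3 ≤? k) ℤ.* 2^χ (4 ≤? k)

-- With x = q^i, this is Σₖ `kindWeight κ k` x^k divided by its value (1 + x)/(1 - x) for `free`.
kindRatio : Kind → ℕ → Series
kindRatio free       i = 𝟏
kindRatio atMostOnce i = 𝟏 - q^ i
kindRatio twice      i = q^ i * q^ i
kindRatio thrice     i = q^ i * q^ i * q^ i

geom-kindWeight : ∀ κ m y → (𝟏 - q^ suc m) * geom m (λ k → const (kindWeight κ k) * y) ≈
                  (𝟏 + q^ suc m) * (kindRatio κ (suc m) * y)
geom-kindWeight free m y = trans (geom-eventually m (λ k → const (kindWeight free k) * y) (λ _ → refl))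
  (solve 2 (λ X y → (:1 :- X) :* (:1 :* y) :+ X :* (:2 :* y) := (:1 :+ X) :* (:1 :* y)) refl (q^ suc m) y)
geom-kindWeight atMostOnce m y = trans (*-congˡ (geom-two m (λ k → const (kindWeight atMostOnce k) * y)
    (λ _ → solve 1 (λ y → con 0ℤ :* y := con 0ℤ) refl y)))
  (solve 2 (λ X y → (:1 :- X) :* (:1 :* y :+ X :* (:1 :* y)) := (:1 :+ X) :* ((:1 :- X) :* y)) refl (q^ suc m) y)
geom-kindWeight twice m y = combine₃ (𝟏 - X) ((𝟏 - X) * X) (X * X)
  (geom-rec m Y) (geom-rec m (Y ∘ suc)) (geom-eventually m (Y ∘ suc ∘ suc) (λ _ → refl))
  (solve 5 (λ X y G G′ G″ → (:1 :- X) :* G := (:1 :+ X) :* (X :* X :* y)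
     :+ (:1 :- X) :* (G :- (con 0ℤ :* y :+ X :* G′)) :+ (:1 :- X) :* X :* (G′ :- (con 0ℤ :* y :+ X :* G″))
     :+ X :* X :* ((:1 :- X) :* G″ :- ((:1 :- X) :* (:1 :* y) :+ X :* (:2 :* y))))
   refl X y (geom m Y) (geom m (Y ∘ suc)) (geom m (Y ∘ suc ∘ suc)))
  where
  X = q^ suc m
  Y : ℕ → Series
  Y k = const (kindWeight twice k) * y
geom-kindWeight thrice m y = combine₄ (𝟏 - X) ((𝟏 - X) * X) ((𝟏 - X) * X * X) (X * X * X)
  (geom-rec m Y) (geom-rec m (Y ∘ suc)) (geom-rec m (Y ∘ suc ∘ suc))
  (geom-eventually m (Y ∘ suc ∘ suc ∘ suc) (λ _ → refl))
  (solve 6 (λ X y G G′ G″ G‴ → (:1 :- X) :* G := (:1 :+ X) :* (X :* X :* X :* y)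
     :+ (:1 :- X) :* (G :- (con 0ℤ :* y :+ X :* G′)) :+ (:1 :- X) :* X :* (G′ :- (con 0ℤ :* y :+ X :* G″))
     :+ (:1 :- X) :* X :* X :* (G″ :- (con 0ℤ :* y :+ X :* G‴))
     :+ X :* X :* X :* ((:1 :- X) :* G‴ :- ((:1 :- X) :* (:1 :* y) :+ X :* (:2 :* y))))
   refl X y (geom m Y) (geom m (Y ∘ suc)) (geom m (Y ∘ suc ∘ suc)) (geom m (Y ∘ suc ∘ suc ∘ suc)))
  where
  X = q^ suc m
  Y : ℕ → Series
  Y k = const (kindWeight thrice k) * y

-- Weights that are products over the part sizes

prodWeight : (ℕ → Kind) → ℕ → List ℕ → ℤ
prodWeight κ zero    π = 1ℤ
prodWeight κ (suc m) π = kindWeight (κ (suc m)) (freq (suc m) π) ℤ.* prodWeight κ m π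

prodRatio : (ℕ → Kind) → ℕ → Series
prodRatio κ zero    = 𝟏
prodRatio κ (suc m) = kindRatio (κ (suc m)) (suc m) * prodRatio κ m

freq-replicate-≡ : ∀ k {x ρ} → All (x ≢_) ρ → freq x (replicate k x ++ ρ) ≡ k
freq-replicate-≡ zero    {x} x∉ρ = cong length (filter-none (x ≟_) x∉ρ)
freq-replicate-≡ (suc k) {x} x∉ρ =
  ≡.trans (cong length (filter-accept (x ≟_) ≡.refl)) (cong suc (freq-replicate-≡ k x∉ρ))

freq-replicate-≢ : ∀ k {i x} ρ → i ≢ x → freq i (replicate k x ++ ρ) ≡ freq i ρ
freq-replicate-≢ zero    ρ i≢x = ≡.refl
freq-replicate-≢ (suc k) {i} ρ i≢x =
  ≡.trans (cong length (filter-reject (i ≟_) i≢x)) (freq-replicate-≢ k ρ i≢x)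

prodWeight-replicate-< : ∀ κ k {x} m ρ → m ℕ.< x → prodWeight κ m (replicate k x ++ ρ) ≡ prodWeight κ m ρ
prodWeight-replicate-< κ k zero    ρ m<x = ≡.refl
prodWeight-replicate-< κ k (suc m) ρ m<x = cong₂ ℤ._*_
  (cong (kindWeight (κ (suc m))) (freq-replicate-≢ k ρ (<⇒≢ m<x)))
  (prodWeight-replicate-< κ k m ρ (<⇒≤ m<x))

prodWeight-replicate : ∀ κ k {m ρ} → All (ℕ._≤ m) ρ →
  prodWeight κ (suc m) (replicate k (suc m) ++ ρ) ≡ kindWeight (κ (suc m)) k ℤ.* prodWeight κ m ρ
prodWeight-replicate κ k {m} {ρ} ρ≤m = cong₂ ℤ._*_
  (cong (kindWeight (κ (suc m))) (freq-replicate-≡ k (All-≤⇒All-≢ ρ≤m)))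
  (prodWeight-replicate-< κ k m ρ ≤-refl)

weighted-prodWeight : ∀ κ m → tailProduct m * weighted m (prodWeight κ m) ≈ tailProduct 0 * prodRatio κ m
weighted-prodWeight κ zero    = *-congˡ (weighted-zero (prodWeight κ 0))
weighted-prodWeight κ (suc m) = 𝟏-q-cancel (q^ m)
  (combine₃ (tailProduct (suc m)) (- (kindRatio (κ (suc m)) (suc m) * W))
    (kindRatio (κ (suc m)) (suc m) * (𝟏 - q^ suc m))
    weights (tailProduct-rec m) (weighted-prodWeight κ m)
    (solve 8 (λ X P P′ P₀ r W W′ R →
      (:1 :- X) :* (P′ :* W′) := (:1 :- X) :* (P₀ :* (r :* R))
      :+ P′ :* ((:1 :- X) :* W′ :- (:1 :+ X) :* (r :* W))
      :+ (:- (r :* W)) :* ((:1 :- X) :* P :- (:1 :+ X) :* P′)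
      :+ r :* (:1 :- X) :* (P :* W :- P₀ :* R))
     refl (q^ suc m) (tailProduct m) (tailProduct (suc m)) (tailProduct 0) (kindRatio (κ (suc m)) (suc m)) W
       (weighted (suc m) (prodWeight κ (suc m))) (prodRatio κ m)))
  where
  W : Series
  W = weighted m (prodWeight κ m)
  weights : (𝟏 - q^ suc m) * weighted (suc m) (prodWeight κ (suc m)) ≈
            (𝟏 + q^ suc m) * (kindRatio (κ (suc m)) (suc m) * W)
  weights = trans (*-congˡ (trans (weighted-suc m (prodWeight κ (suc m)))
      (geom-cong m (λ k → trans (weighted-cong m (λ ρ ρ≤m → prodWeight-replicate κ k ρ≤m))
        (weighted-* m (kindWeight (κ (suc m)) k) (prodWeight κ m))))))
    (geom-kindWeight (κ (suc m)) m W)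

choose : Bool → Bool → Bool → Kind
choose true  _     _     = thrice
choose false true  _     = twice
choose false false true  = atMostOnce
choose false false false = free

-- The conditions in the j-th summand of ω₂*. Products run over indices from 1 on, so `kind 0`
-- restricts only the part 1, and the isolated first term of ω₂* becomes the case j = 0.
kind : ℕ → ℕ → Kind
kind j i = choose (does (i <? j)) (does (i ≟ j)) (does (i ≟ suc j ℕ.+ j))

kind-< : ∀ {j i} → i ℕ.< j → kind j i ≡ thrice
kind-< {j} {i} i<j = cong (λ b → choose b (does (i ≟ j)) (does (i ≟ suc j ℕ.+ j))) (dec-true (i <? j) i<j)

kind-≡ : ∀ j → kind j j ≡ twice
kind-≡ j = cong₂ (λ b c → choose b c (does (j ≟ suc j ℕ.+ j)))
  (dec-false (j <? j) (<-irrefl ≡.refl)) (dec-true (j ≟ j) ≡.refl)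

kind-> : ∀ {j i} → j ℕ.< i → kind j i ≡ choose false false (does (i ≟ suc j ℕ.+ j))
kind-> {j} {i} j<i = cong₂ (λ b c → choose b c (does (i ≟ suc j ℕ.+ j)))
  (dec-false (i <? j) (ℕ.<-asym j<i)) (dec-false (i ≟ j) (λ i≡j → <⇒≢ j<i (≡.sym i≡j)))

kind-atMostOnce : ∀ j → kind j (suc j ℕ.+ j) ≡ atMostOnce
kind-atMostOnce j = ≡.trans (kind-> (s≤s (m≤n+m j j)))
  (cong (choose false false) (dec-true (suc j ℕ.+ j ≟ suc j ℕ.+ j) ≡.refl))

kind-free : ∀ {j i} → j ℕ.< i → i ≢ suc j ℕ.+ j → kind j i ≡ free
kind-free {j} {i} j<i i≢ = ≡.trans (kind-> j<i) (cong (choose false false) (dec-false (i ≟ suc j ℕ.+ j) i≢))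

kindRatio-cong : ∀ {κ κ′} → κ ≡ κ′ → ∀ i y → kindRatio κ i * y ≈ kindRatio κ′ i * y
kindRatio-cong ≡.refl i y = refl

thriceProd : ℕ → Series
thriceProd = prodRatio (λ _ → thrice)

-- leading j = q^(j(3j+1)/2)
leading : ℕ → Series
leading zero    = 𝟏
leading (suc j) = q^ suc j * q^ suc j * thriceProd j

-- The exponent grows by 3j + 2, the power in `falseTheta-rec`; this makes `falseTheta-partial`
-- telescope.
leading-suc : ∀ j → leading (suc j) ≈ leading j * (q^ suc (suc (double j)) * q^ j)
leading-suc zero    = solve 1 (λ Q → Q :* :1 :* (Q :* :1) :* :1 := :1 :* (Q :* (Q :* :1) :* :1)) refl q
leading-suc (suc j) = combine₁ (- (J * J * T * (q * q * J))) (q^double (suc j))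
  (solve 4 (λ Q J D T → Q :* J :* (Q :* J) :* (J :* J :* J :* T) := J :* J :* T :* (Q :* (Q :* D) :* J)
      :+ (:- (J :* J :* T :* (Q :* Q :* J))) :* (D :- J :* J))
    refl q J (q^ double (suc j)) T)
  where
  J T : Series
  J = q^ suc j
  T = thriceProd j

falseTheta-partial : ∀ J →
  ∑ˢ (upTo J) (λ j → leading j * (𝟏 - q^ suc (double j))) + leading J * falseTheta J ≈ falseTheta 0
falseTheta-partial zero    = solve 1 (λ θ → con 0ℤ :+ :1 :* θ := θ) refl (falseTheta 0)
falseTheta-partial (suc J) = trans (+-congʳ (trans
    (reflexive (cong (λ js → ∑ˢ js F) (≡.sym (applyUpTo-∷ʳ id J)))) (∑ˢ-∷ʳ (upTo J) J)))
  (combine₃ 𝟏 (falseTheta (suc J)) (- leading J) (falseTheta-partial J) (leading-suc J) (falseTheta-rec J)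
    (solve 8 (λ S L L′ θ θ′ θ₀ D A →
        S :+ L :* (:1 :- D) :+ L′ :* θ′ := θ₀ :+ :1 :* (S :+ L :* θ :- θ₀)
        :+ θ′ :* (L′ :- L :* A) :+ (:- L) :* (θ :- (:1 :- D :+ A :* θ′)))
      refl (∑ˢ (upTo J) F) (leading J) (leading (suc J)) (falseTheta J) (falseTheta (suc J)) (falseTheta 0)
        (q^ suc (double J)) (q^ suc (suc (double J)) * q^ J)))
  where
  F : ℕ → Series
  F j = leading j * (𝟏 - q^ suc (double j))
  ∑ˢ-∷ʳ : ∀ js j → ∑ˢ (js ++ j ∷ []) F ≈ ∑ˢ js F + F j
  ∑ˢ-∷ʳ []       j = solve 1 (λ x → x :+ con 0ℤ := con 0ℤ :+ x) refl (F j)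
  ∑ˢ-∷ʳ (i ∷ js) j = trans (+-congˡ (∑ˢ-∷ʳ js j))
    (solve 3 (λ a b c → a :+ (b :+ c) := a :+ b :+ c) refl (F i) (∑ˢ js F) (F j))

prodRatio-thrice : ∀ {j} m → m ℕ.< j → prodRatio (kind j) m ≈ thriceProd m
prodRatio-thrice zero    m<j = refl
prodRatio-thrice (suc m) m<j = trans (kindRatio-cong (kind-< m<j) (suc m) _)
  (*-congˡ (prodRatio-thrice m (<⇒≤ m<j)))

prodRatio-≡ : ∀ j → prodRatio (kind j) j ≈ leading j
prodRatio-≡ zero    = refl
prodRatio-≡ (suc j) = trans (kindRatio-cong (kind-≡ (suc j)) (suc j) _) (*-congˡ (prodRatio-thrice j ≤-refl))

prodRatio-free : ∀ j m → j ℕ.≤ m → suc m ≢ suc j ℕ.+ j → prodRatio (kind j) (suc m) ≈ prodRatio (kind j) m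
prodRatio-free j m j≤m m≢ = trans (kindRatio-cong (kind-free (s≤s j≤m) m≢) (suc m) _)
  (solve 1 (λ x → :1 :* x := x) refl (prodRatio (kind j) m))

prodRatio-below : ∀ j d → d ℕ.≤ j → prodRatio (kind j) (d ℕ.+ j) ≈ leading j
prodRatio-below j zero    _   = prodRatio-≡ j
prodRatio-below j (suc d) d<j = trans
  (prodRatio-free j (d ℕ.+ j) (m≤n+m j d)
    (λ eq → <⇒≢ d<j (suc-injective (ℕ.+-cancelʳ-≡ j _ _ (cong suc (suc-injective eq))))))
  (prodRatio-below j d (<⇒≤ d<j))

double≡ : ∀ j → double j ≡ j ℕ.+ j
double≡ zero    = ≡.refl
double≡ (suc j) = cong suc (≡.trans (cong suc (double≡ j)) (≡.sym (+-suc j j)))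

prodRatio-above : ∀ j d → prodRatio (kind j) (d ℕ.+ (suc j ℕ.+ j)) ≈ leading j * (𝟏 - q^ suc (double j))
prodRatio-above j zero    = trans (kindRatio-cong (kind-atMostOnce j) (suc j ℕ.+ j) _)
  (trans (*-cong (reflexive (cong (λ k → 𝟏 - q^ suc k) (≡.sym (double≡ j)))) (prodRatio-below j j ≤-refl))
    (*-comm _ _))
prodRatio-above j (suc d) = trans
  (prodRatio-free j (d ℕ.+ (suc j ℕ.+ j)) (≤-trans (m≤n+m j (suc j)) (m≤n+m _ d))
    (λ eq → <-irrefl (≡.sym eq) (s≤s (m≤n+m _ d))))
  (prodRatio-above j d)

-- When n < 2j + 1 the product stops before the factor 1 - q^(2j+1), but that factor is 1 modulo
-- q^(n+1).
prodRatio-≈[] : ∀ j n → j ℕ.≤ n → prodRatio (kind j) n ≈[ suc n ] leading j * (𝟏 - q^ suc (double j))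
prodRatio-≈[] j n j≤n with suc j ℕ.+ j ≤? n
... | yes a≤n = ≈⇒≈[] (trans (reflexive (cong (prodRatio (kind j)) (≡.sym (m∸n+n≡m a≤n))))
    (prodRatio-above j (n ℕ.∸ (suc j ℕ.+ j))))
... | no  a≰n = ≈[]-sym (≈[]-trans (≈⇒≈[] expand) (≈[]-trans
    (λ i i≤n → +q^*-≈[] (suc (double j)) (leading j) (- leading j) i (<-≤-trans i≤n n<a))
    (≈⇒≈[] (sym (trans (reflexive (cong (prodRatio (kind j)) (≡.sym (m∸n+n≡m j≤n))))
      (prodRatio-below j (n ℕ.∸ j) d≤j))))))
  where
  n<a : suc n ℕ.≤ suc (double j)
  n<a = ≡.subst (λ k → suc n ℕ.≤ suc k) (≡.sym (double≡ j)) (ℕ.≰⇒> a≰n)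
  d≤j : n ℕ.∸ j ℕ.≤ j
  d≤j = ℕ.m≤n+o⇒m∸n≤o n j (ℕ.≤-pred (ℕ.≰⇒> a≰n))
  expand : leading j * (𝟏 - q^ suc (double j)) ≈ leading j + q^ suc (double j) * (- leading j)
  expand = solve 2 (λ L D → L :* (:1 :- D) := L :+ D :* (:- L)) refl (leading j) (q^ suc (double j))

-- The summands of ω₂* as products over the part sizes

∏-++ : ∀ {A : Set} (xs ys : List A) f → ∏ (xs ++ ys) f ≡ ∏ xs f ℤ.* ∏ ys f
∏-++ []       ys f = ≡.sym (ℤ.*-identityˡ _)
∏-++ (x ∷ xs) ys f = ≡.trans (cong (ℤ._*_ (f x)) (∏-++ xs ys f)) (≡.sym (ℤ.*-assoc (f x) _ _))

∏-congᵃ : ∀ {A : Set} {xs : List A} (f g : A → ℤ) → All (λ x → f x ≡ g x) xs → ∏ xs f ≡ ∏ xs g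
∏-congᵃ f g []       = ≡.refl
∏-congᵃ f g (p ∷ ps) = cong₂ ℤ._*_ p (∏-congᵃ f g ps)

∏-applyUpTo-suc : ∀ (f : ℕ → ℕ) n g → ∏ (applyUpTo f (suc n)) g ≡ ∏ (applyUpTo f n) g ℤ.* g (f n)
∏-applyUpTo-suc f n g = ≡.trans (cong (λ xs → ∏ xs g) (≡.sym (applyUpTo-∷ʳ f n)))
  (≡.trans (∏-++ (applyUpTo f n) (f n ∷ []) g) (cong (ℤ._*_ (∏ (applyUpTo f n) g)) (ℤ.*-identityʳ (g (f n)))))

factor : (ℕ → Kind) → List ℕ → ℕ → ℤ
factor κ π i = kindWeight (κ i) (freq i π)

prodWeight-split : ∀ κ j d π →
  prodWeight κ (j ℕ.+ d) π ≡ prodWeight κ j π ℤ.* ∏ (applyUpTo (λ i → suc j ℕ.+ i) d) (factor κ π)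
prodWeight-split κ j zero    π = ≡.trans (cong (λ m → prodWeight κ m π) (+-identityʳ j)) (≡.sym (ℤ.*-identityʳ _))
prodWeight-split κ j (suc d) π = ≡.trans (cong (λ m → prodWeight κ m π) (+-suc j d)) (≡.trans
  (cong (ℤ._*_ x) (prodWeight-split κ j d π))
  (≡.trans (rotate x P Q) (cong (ℤ._*_ P) (≡.sym (∏-applyUpTo-suc (λ i → suc j ℕ.+ i) d (factor κ π))))))
  where
  x P Q : ℤ
  x = factor κ π (suc (j ℕ.+ d))
  P = prodWeight κ j π
  Q = ∏ (applyUpTo (λ i → suc j ℕ.+ i) d) (factor κ π)
  rotate : ∀ a b c → a ℤ.* (b ℤ.* c) ≡ b ℤ.* (c ℤ.* a)
  rotate = solve-∀

module _ (π : List ℕ) (j : ℕ) where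

  -- The excluded index 2j + 1 sits at offset j, hence the distinction between d ≤ j and d > j.
  above : ℕ → List ℕ
  above = applyUpTo (λ i → suc j ℕ.+ i)

  ≢a? : Decidable (_≢ 2 ℕ.* j ℕ.+ 1)
  ≢a? i = ¬? (i ≟ 2 ℕ.* j ℕ.+ 1)

  a≡ : 2 ℕ.* j ℕ.+ 1 ≡ suc j ℕ.+ j
  a≡ = ≡.trans (ℕ.+-comm (2 ℕ.* j) 1) (cong (λ k → suc (j ℕ.+ k)) (+-identityʳ j))

  freeFactor : ℕ → ℤ
  freeFactor i = 2^χ (1 ≤? freq i π)

  factor-free : ∀ i → i ≢ j → factor (kind j) π (suc j ℕ.+ i) ≡ freeFactor (suc j ℕ.+ i)
  factor-free i i≢j = cong (λ κ → kindWeight κ (freq (suc j ℕ.+ i) π))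
    (kind-free (s≤s (ℕ.m≤m+n j i)) (i≢j ∘ ℕ.+-cancelˡ-≡ (suc j) i j))

  ∏-above-short : ∀ d → d ℕ.≤ j → ∏ (above d) (factor (kind j) π) ≡ ∏ (filter ≢a? (above d)) freeFactor
  ∏-above-short d d≤j = ≡.trans
    (∏-congᵃ (factor (kind j) π) freeFactor (All.applyUpTo⁺₁ (λ i → suc j ℕ.+ i) d
      (λ {i} i<d → factor-free i (<⇒≢ (<-≤-trans i<d d≤j)))))
    (cong (λ is → ∏ is freeFactor) (≡.sym (filter-all ≢a? (All.applyUpTo⁺₁ (λ i → suc j ℕ.+ i) d
      (λ {i} i<d eq → <⇒≢ (<-≤-trans i<d d≤j) (ℕ.+-cancelˡ-≡ (suc j) i j (≡.trans eq a≡)))))))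

  ∏-filter-above : ∀ d → d ≢ j → ∏ (filter ≢a? (above (suc d))) freeFactor ≡
                   ∏ (filter ≢a? (above d)) freeFactor ℤ.* freeFactor (suc j ℕ.+ d)
  ∏-filter-above d d≢j = ≡.trans
    (cong (λ is → ∏ (filter ≢a? is) freeFactor) (≡.sym (applyUpTo-∷ʳ (λ i → suc j ℕ.+ i) d)))
    (≡.trans (cong (λ is → ∏ is freeFactor) (≡.trans (filter-++ ≢a? (above d) (suc j ℕ.+ d ∷ []))
        (cong (above′ ++_) (filter-accept ≢a? (λ eq → d≢j (ℕ.+-cancelˡ-≡ (suc j) d j (≡.trans eq a≡)))))))
      (≡.trans (∏-++ above′ (suc j ℕ.+ d ∷ []) freeFactor)
        (cong (ℤ._*_ (∏ above′ freeFactor)) (ℤ.*-identityʳ (freeFactor (suc j ℕ.+ d))))))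
    where
    above′ : List ℕ
    above′ = filter ≢a? (above d)

  onceFactor : ℤ
  onceFactor = χ (freq (2 ℕ.* j ℕ.+ 1) π ≤? 1)

  ∏-above-long : ∀ d → ∏ (above (d ℕ.+ suc j)) (factor (kind j) π) ≡
                 onceFactor ℤ.* ∏ (filter ≢a? (above (d ℕ.+ suc j))) freeFactor
  ∏-above-long zero    = ≡.trans (∏-applyUpTo-suc (λ i → suc j ℕ.+ i) j (factor (kind j) π))
    (≡.trans (cong₂ ℤ._*_ (∏-above-short j ≤-refl)
        (≡.trans (cong (λ κ → kindWeight κ (freq (suc j ℕ.+ j) π)) (kind-atMostOnce j))
          (cong (λ a → χ (freq a π ≤? 1)) (≡.sym a≡))))
      (≡.trans (ℤ.*-comm (∏ (filter ≢a? (above j)) freeFactor) onceFactor)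
        (cong (ℤ._*_ onceFactor) (cong (λ is → ∏ is freeFactor) (≡.sym reject)))))
    where
    reject : filter ≢a? (above (suc j)) ≡ filter ≢a? (above j)
    reject = ≡.trans (cong (filter ≢a?) (≡.sym (applyUpTo-∷ʳ (λ i → suc j ℕ.+ i) j)))
      (≡.trans (filter-++ ≢a? (above j) (suc j ℕ.+ j ∷ []))
        (≡.trans (cong (filter ≢a? (above j) ++_) (filter-reject ≢a? (λ ≢a → ≢a (≡.sym a≡))))
          (List.++-identityʳ _)))
  ∏-above-long (suc d) = ≡.trans (∏-applyUpTo-suc (λ i → suc j ℕ.+ i) (d ℕ.+ suc j) (factor (kind j) π))
    (≡.trans (cong₂ ℤ._*_ (∏-above-long d) (factor-free (d ℕ.+ suc j) ≢j))
      (≡.trans (ℤ.*-assoc onceFactor _ _) (cong (ℤ._*_ onceFactor) (≡.sym (∏-filter-above (d ℕ.+ suc j) ≢j)))))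
    where
    ≢j : d ℕ.+ suc j ≢ j
    ≢j eq = <-irrefl (≡.sym eq) (m≤n+m (suc j) d)

  ∏-above : ∀ d → size π ≡ j ℕ.+ d →
    ∏ (above d) (factor (kind j) π) ≡ onceFactor ℤ.* ∏ (filter ≢a? (above d)) freeFactor
  ∏-above d size≡ with suc j ≤? d
  ... | yes j<d = ≡.subst
    (λ d → ∏ (above d) (factor (kind j) π) ≡ onceFactor ℤ.* ∏ (filter ≢a? (above d)) freeFactor)
    (m∸n+n≡m j<d) (∏-above-long (d ℕ.∸ suc j))
  -- Here 2j + 1 exceeds |π|, so it is not a part and `onceFactor` is 1.
  ... | no  j≮d = ≡.trans (∏-above-short d d≤j) (≡.trans (≡.sym (ℤ.*-identityˡ _))
    (cong (ℤ._* ∏ (filter ≢a? (above d)) freeFactor) (≡.sym (cong (λ k → χ (k ≤? 1)) absent))))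
    where
    d≤j : d ℕ.≤ j
    d≤j = ℕ.≤-pred (ℕ.≰⇒> j≮d)
    absent : freq (2 ℕ.* j ℕ.+ 1) π ≡ 0
    absent = freq-above π (≡.subst₂ ℕ._<_ (≡.sym size≡) (≡.sym a≡) (s≤s (ℕ.+-monoʳ-≤ j d≤j)))

thriceFactor : List ℕ → ℕ → ℤ
thriceFactor π i = χ (3 ≤? freq i π) ℤ.* 2^χ (4 ≤? freq i π)

prodWeight-thrice : ∀ {j} m π → m ℕ.< j → prodWeight (kind j) m π ≡ ∏ (range 1 m) (thriceFactor π)
prodWeight-thrice     zero    π m<j = ≡.refl
prodWeight-thrice {j} (suc m) π m<j = ≡.trans
  (cong₂ ℤ._*_ (cong (λ κ → kindWeight κ (freq (suc m) π)) (kind-< m<j)) (prodWeight-thrice m π (<⇒≤ m<j)))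
  (≡.trans (ℤ.*-comm (thriceFactor π (suc m)) (∏ (range 1 m) (thriceFactor π)))
    (≡.sym (∏-applyUpTo-suc suc m (thriceFactor π))))

starTerm : List ℕ → ℕ → ℤ
starTerm π j =
  χ (freq (2 ℕ.* j ℕ.+ 1) π ≤? 1) ℤ.* χ (2 ≤? freq j π) ℤ.* 2^χ (3 ≤? freq j π)
  ℤ.* ∏ (range 1 (j ℕ.∸ 1)) (thriceFactor π)
  ℤ.* ∏ (filter (λ n → ¬? (n ≟ 2 ℕ.* j ℕ.+ 1)) (range (suc j) (size π))) (λ n → 2^χ (1 ≤? freq n π))

starTerm-prodWeight : ∀ π i → i ℕ.< size π → starTerm π (suc i) ≡ prodWeight (kind (suc i)) (size π) π
starTerm-prodWeight π i i<N = ≡.sym (begin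
  prodWeight (kind j) (size π) π    ≡⟨ cong (λ m → prodWeight (kind j) m π) size≡ ⟩
  prodWeight (kind j) (j ℕ.+ d) π   ≡⟨ prodWeight-split (kind j) j d π ⟩
  kindWeight (kind j j) (freq j π) ℤ.* prodWeight (kind j) i π ℤ.* ∏ (above π j d) (factor (kind j) π)
    ≡⟨ cong₂ ℤ._*_ (cong₂ ℤ._*_ (cong (λ κ → kindWeight κ (freq j π)) (kind-≡ j)) (prodWeight-thrice i π ≤-refl))
                   (∏-above π j d size≡) ⟩
  χ (2 ≤? freq j π) ℤ.* 2^χ (3 ≤? freq j π) ℤ.* T ℤ.* (onceFactor π j ℤ.* F)
    ≡⟨ regroup (χ (2 ≤? freq j π)) (2^χ (3 ≤? freq j π)) T (onceFactor π j) F ⟩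
  starTerm π j                      ∎)
  where
  open ≡.≡-Reasoning
  j d : ℕ
  j = suc i
  d = size π ℕ.∸ j
  size≡ : size π ≡ j ℕ.+ d
  size≡ = ≡.sym (ℕ.m+[n∸m]≡n i<N)
  T F : ℤ
  T = ∏ (range 1 i) (thriceFactor π)
  F = ∏ (filter (≢a? π j) (above π j d)) (freeFactor π j)
  regroup : ∀ a b t o f → a ℤ.* b ℤ.* t ℤ.* (o ℤ.* f) ≡ o ℤ.* a ℤ.* b ℤ.* t ℤ.* f
  regroup = solve-∀

1-χ : ∀ k → 1ℤ ℤ.- χ (2 ≤? k) ≡ χ (k ≤? 1)
1-χ zero          = ≡.refl
1-χ (suc zero)    = ≡.refl
1-χ (suc (suc k)) = ≡.refl

starTerm₀-prodWeight : ∀ π N → size π ≡ N →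
  (1ℤ ℤ.- χ (2 ≤? freq 1 π)) ℤ.* ∏ (range 2 N) (λ n → 2^χ (1 ≤? freq n π)) ≡ prodWeight (kind 0) N π
starTerm₀-prodWeight π zero    size≡ rewrite freq-above {1} π (≡.subst (ℕ._< 1) (≡.sym size≡) ≤-refl) = ≡.refl
starTerm₀-prodWeight π (suc N) size≡ = ≡.sym (≡.trans (prodWeight-split (kind 0) 1 N π)
  (cong₂ ℤ._*_ (≡.trans (ℤ.*-identityʳ (χ (freq 1 π ≤? 1))) (≡.sym (1-χ (freq 1 π))))
    (∏-congᵃ (factor (kind 0) π) (λ n → 2^χ (1 ≤? freq n π)) (All.applyUpTo⁺₁ (λ i → 2 ℕ.+ i) N (λ _ → ≡.refl)))))

ω₂*-prodWeight : ∀ n π → size π ≡ n → ω₂* π ≡ ∑ (upTo (suc n)) (λ j → prodWeight (kind j) n π)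
ω₂*-prodWeight n π ≡.refl = cong₂ ℤ._+_ (starTerm₀-prodWeight π n ≡.refl)
  (∑-congᵃ {f = starTerm π} {g = λ j → prodWeight (kind j) n π}
    (All.applyUpTo⁺₁ suc n (λ {i} i<n → starTerm-prodWeight π i i<n)))

weighted-prodWeight-coeff : ∀ κ n → coeff (weighted n (prodWeight κ n)) n ≡ coeff (tailProduct 0 * prodRatio κ n) n
weighted-prodWeight-coeff κ n = ≡.trans (≡.sym (+q^*-≈[] (suc n) W (y * W) n ≤-refl)) (coeff-cong
  (combine₂ 𝟏 (- W) (weighted-prodWeight κ n) (proj₂ (tailProduct-congruent-𝟏 n))
    (solve 5 (λ X y W P R → W :+ X :* (y :* W) := R :+ :1 :* (P :* W :- R) :+ (:- W) :* (P :- (:1 :+ X :* y)))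
      refl (q^ suc n) y W (tailProduct n) (tailProduct 0 * prodRatio κ n))) n)
  where
  W y : Series
  W = weighted n (prodWeight κ n)
  y = proj₁ (tailProduct-congruent-𝟏 n)

leading-remainder : ∀ n y → leading (suc n) * y ≈ q^ suc n * (q^ suc n * thriceProd n * y)
leading-remainder n y = solve 3 (λ X T y → X :* X :* T :* y := X :* (X :* T :* y)) refl (q^ suc n) (thriceProd n) y

∑q-ω₂* : ∑q 𝒰 ω₂* ≗ coeff common
∑q-ω₂* n = begin
  ∑ (𝒰 n) ω₂*
    ≡⟨ ∑-𝒰-cong n ω₂* (λ π → ∑ js (λ j → prodWeight (kind j) n π)) (ω₂*-prodWeight n) ⟩
  ∑ (𝒰 n) (λ π → ∑ js (λ j → prodWeight (kind j) n π))
    ≡⟨ ∑-swap (𝒰 n) js (λ π j → prodWeight (kind j) n π) ⟩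
  ∑ js (λ j → ∑ (𝒰 n) (prodWeight (kind j) n))
    ≡⟨ ∑-congᵃ {f = λ j → ∑ (𝒰 n) (prodWeight (kind j) n)} (All.applyUpTo⁺₁ id (suc n) (λ {j} j≤n → term j j≤n)) ⟩
  ∑ js (λ j → coeff (tailProduct 0 * F j) n)
    ≡⟨ coeff-∑ˢ js (λ j → tailProduct 0 * F j) n ⟨
  coeff (∑ˢ js (λ j → tailProduct 0 * F j)) n
    ≡⟨ coeff-cong (∑ˢ-*ˡ js (tailProduct 0) F) n ⟩
  coeff (tailProduct 0 * ∑ˢ js F) n
    ≡⟨ +q^*-≈[] (suc n) (tailProduct 0 * ∑ˢ js F) (tailProduct 0 * R) n ≤-refl ⟨
  coeff (tailProduct 0 * ∑ˢ js F + q^ suc n * (tailProduct 0 * R)) n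
    ≡⟨ coeff-cong (combine₂ (- tailProduct 0) (tailProduct 0) (leading-remainder n θ) (falseTheta-partial (suc n))
         (solve 6 (λ P S X R L θ₀ → P :* S :+ X :* (P :* R) :=
             P :* θ₀ :+ (:- P) :* (L :- X :* R) :+ P :* (S :+ L :- θ₀))
           refl (tailProduct 0) (∑ˢ js F) (q^ suc n) R (leading (suc n) * θ) (falseTheta 0))) n ⟩
  coeff common n ∎
  where
  open ≡.≡-Reasoning
  js : List ℕ
  js = upTo (suc n)
  F : ℕ → Series
  F j = leading j * (𝟏 - q^ suc (double j))
  θ R : Series
  θ = falseTheta (suc n)
  R = q^ suc n * thriceProd n * θ
  term : ∀ j → j ℕ.< suc n → ∑ (𝒰 n) (prodWeight (kind j) n) ≡ coeff (tailProduct 0 * F j) n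
  term j (s≤s j≤n) = ≡.trans (≡.sym (coeff-series _ n)) (≡.trans (weighted-prodWeight-coeff (kind j) n)
    (≈[]-* (tailProduct 0) (prodRatio-≈[] j n j≤n) n ≤-refl))

theorem4p4 : (∑q 𝒟 ω̃₂ ≗ ∑q 𝒰 ω₂′) × (∑q 𝒰 ω₂′ ≗ ∑q 𝒰 ω₂*)
theorem4p4 = (λ n → ≡.trans (∑q-ω̃₂ n) (≡.sym (∑q-ω₂′ n))) , (λ n → ≡.trans (∑q-ω₂′ n) (≡.sym (∑q-ω₂* n)))
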